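{- Fix a positive integer $k$. For every $\epsilon > 0$ there exists $n_0$ (depending only on $k$ and $\epsilon$) such that for every $n \geq n_0$, every $k$-generator $\mathcal{G}$ of $\mathbb{P}[n]$ satisfies \[|\mathcal{G}| \geq (1-\epsilon)\, k\, 2^{n/k}.\] Equivalently, any $k$-generator of $\mathbb{P}[n]$ has at least $k2^{n/k}(1-o(1))$ members, where $o(1) \to 0$ as $n \to \infty$ for fixed $k$.
   Context: $\mathbb{P}[n]$ denotes the power set of $[n]=\{1,\ldots,n\}$. A family $\mathcal{G} \subset \mathbb{P}[n]$ is called a $k$-generator of $\mathbb{P}[n]$ if every $x \subset [n]$ can be expressed as a union of at most $k$ pairwise disjoint sets belonging to $\mathcal{G}$. -}

module Defs where

open import Data.Nat using (ℕ; _≤_)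
open import Data.List using (List; length)
open import Data.List.Membership.Propositional using (_∈_)
open import Data.List.Relation.Unary.All using (All)
open import Data.List.Relation.Unary.AllPairs using (AllPairs)
open import Data.List.Relation.Unary.Unique.Propositional using (Unique)
open import Data.Fin.Subset using (Subset; _∩_; ⊥; ⋃)
open import Data.Product using (Σ; _×_)
open import Relation.Binary.PropositionalEquality using (_≡_)

-- Subsets of [n] are represented by Subset n (characteristic vectors).
-- A family 𝒢 ⊆ ℙ[n] is a duplicate-free list of subsets; |𝒢| = length.

Disjoint : ∀ {n} → Subset n → Subset n → Set
Disjoint p q = p ∩ q ≡ ⊥

IsKGenerator : (k n : ℕ) → List (Subset n) → Set
IsKGenerator k n G =
  (x : Subset n) → Σ (List (Subset n)) λ ys →
    length ys ≤ k × All (_∈ G) ys × AllPairs Disjoint ys × ⋃ ys ≡ x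

-- Let V be the nonempty members of 𝒢, m = ∣V∣, and A s the number of ordered s-tuples of pairwise
-- disjoint members of V. Sets that are unions of fewer than k members number only O(m^(k-1)), and
-- any other set accounts for k! ordered k-tuples, so A k ≥ (1 - o(1)) k! 2^n.
--
-- If m = O(2^(n/k)), the pairwise disjoint (k+1)-tuples have density o(1) (after Alon and Frankl).
-- Otherwise, by convexity, one can choose a bounded number of members of V whose union w is
-- disjoint from a dense set of k-tuples; as only 2^∣w∣ subsets lie below w, a union bound forces
-- ∣w∣ > n/(k+1). Repeating this with the k-tuples inside the complement of w, one obtains k + 1
-- disjoint sets of size > n/(k+1).
--
-- By the Moon–Moser inequalities, A (k+1) = o(m A k) forces A k ≤ (1 + o(1)) (k!/k^k) m^k.
-- Comparing the two bounds on A k gives m ≥ (1 - o(1)) k 2^(n/k).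

module Submission where

open import Defs
open import Data.Bool as Bool using ()
open import Data.Fin.Subset using (Subset; inside; outside; _∪_; ⊥; ∣_∣; ⋃)
open import Data.Fin.Subset.Properties
  using (∪-comm; ∪-assoc; ∪-identityˡ; ∪-identityʳ; ∪-isCommutativeMonoid; ∩-idem; ∩-comm; ∣p∣≤n; ∣⊥∣≡0)
open import Data.List using (List; []; _∷_; length; map; _++_; filter; upTo)
open import Data.List.Membership.Propositional using (_∈_)
open import Data.List.Membership.Propositional.Properties
  using (∈-∃++; ∈-map⁺; ∈-++⁺ˡ; ∈-++⁺ʳ; ∈-filter⁺; ∈-filter⁻; ∈-upTo⁺; ∈-upTo⁻)
open import Data.List.Properties using (length-++; length-map; length-filter; length-upTo; map-++; map-∘)
open import Data.List.Relation.Binary.Permutation.Propositional using (_↭_; ↭⇒↭ₛ)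
open import Data.List.Relation.Binary.Permutation.Propositional.Properties
  using (shift; map⁺; ∈-resp-↭; All-resp-↭; ↭-length)
import Data.List.Relation.Binary.Permutation.Setoid.Properties as Permutationₛ
open import Data.List.Relation.Unary.All as All using (All; []; _∷_)
open import Data.List.Relation.Unary.All.Properties using (all-filter)
open import Data.List.Relation.Unary.AllPairs using (AllPairs; []; _∷_)
open import Data.List.Relation.Unary.AllPairs.Properties using () renaming (filter⁺ to AllPairs-filter⁺)
open import Data.List.Relation.Unary.Any using (here; there)
open import Data.List.Relation.Unary.Unique.Propositional using (Unique)
open import Data.List.Relation.Unary.Unique.Propositional.Properties using () renaming (filter⁺ to Unique-filter⁺)
open import Data.Nat
open import Data.Nat.ListAction using (sum)
open import Data.Nat.ListAction.Properties using (sum-++; sum-↭)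
open import Data.Nat.Properties
open import Data.Nat.Tactic.RingSolver using (solve-∀)
open import Data.Product using (Σ; _×_; _,_)
open import Data.Sum using (_⊎_; inj₁; inj₂)
open import Data.Vec using ([]; _∷_)
open import Data.Vec.Properties using (∷-injectiveʳ; ≡-dec)
open import Function using (it)
open import Relation.Binary.PropositionalEquality
open import Relation.Nullary using (Dec; ¬?; yes; no; contradiction)

-- Arithmetic

m≤2^m : ∀ m → m ≤ 2 ^ m
m≤2^m zero    = z≤n
m≤2^m (suc m) = begin
  1 + m          ≤⟨ +-mono-≤ (m^n>0 2 m) (m≤2^m m) ⟩
  2 ^ m + 2 ^ m  ≡⟨ cong (2 ^ m +_) (+-identityʳ (2 ^ m)) ⟨
  2 ^ suc m      ∎
  where open ≤-Reasoning

^-cancelʳ-≤ : ∀ c .{{_ : NonZero c}} {a b} → a ^ c ≤ b ^ c → a ≤ b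
^-cancelʳ-≤ c a^c≤b^c = ≮⇒≥ λ b<a → <⇒≱ (^-monoˡ-< c b<a) a^c≤b^c

^-distribʳ-* : ∀ c a b → (a * b) ^ c ≡ a ^ c * b ^ c
^-distribʳ-* zero    a b = refl
^-distribʳ-* (suc c) a b = begin
  a * b * (a * b) ^ c        ≡⟨ cong (a * b *_) (^-distribʳ-* c a b) ⟩
  a * b * (a ^ c * b ^ c)    ≡⟨ lemma a b (a ^ c) (b ^ c) ⟩
  a * a ^ c * (b * b ^ c)    ∎
  where
  open ≡-Reasoning
  lemma : ∀ a b x y → a * b * (x * y) ≡ a * x * (b * y)
  lemma = solve-∀

square-cancel-≤ : ∀ {a b} → a * a ≤ b * b → a ≤ b
square-cancel-≤ a²≤b² = ≮⇒≥ λ b<a → <⇒≱ (*-mono-< b<a b<a) a²≤b²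

am-gm : ∀ a b → 4 * (a * b) ≤ (a + b) * (a + b)
am-gm a b with ≤-total a b
... | inj₁ a≤b with m≤n⇒∃[o]m+o≡n a≤b
...   | c , refl = subst (4 * (a * (a + c)) ≤_) (lemma a c) (m≤m+n _ (c * c))
  where
  lemma : ∀ a c → 4 * (a * (a + c)) + c * c ≡ (a + (a + c)) * (a + (a + c))
  lemma = solve-∀
am-gm a b | inj₂ b≤a with m≤n⇒∃[o]m+o≡n b≤a
...   | c , refl = subst (4 * ((b + c) * b) ≤_) (lemma b c) (m≤m+n _ (c * c))
  where
  lemma : ∀ b c → 4 * ((b + c) * b) + c * c ≡ (b + c + b) * (b + c + b)
  lemma = solve-∀

-- The inductive step of Cauchy-Schwarz without square roots: the cross term 2ab is at most ps + rq,
-- since its square is at most 4(ps)(rq) and AM-GM applies.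
cauchy-schwarz₂ : ∀ {a b p q r s} → a * a ≤ p * q → b * b ≤ r * s →
  (a + b) * (a + b) ≤ (p + r) * (q + s)
cauchy-schwarz₂ {a} {b} {p} {q} {r} {s} a²≤ b²≤ = begin
  (a + b) * (a + b)                    ≡⟨ expand a b ⟩
  a * a + 2 * (a * b) + b * b          ≤⟨ +-mono-≤ (+-mono-≤ a²≤ (square-cancel-≤ cross)) b²≤ ⟩
  p * q + (p * s + r * q) + r * s      ≡⟨ collect p q r s ⟩
  (p + r) * (q + s)                    ∎
  where
  open ≤-Reasoning
  expand : ∀ a b → (a + b) * (a + b) ≡ a * a + 2 * (a * b) + b * b
  expand = solve-∀
  collect : ∀ p q r s → p * q + (p * s + r * q) + r * s ≡ (p + r) * (q + s)
  collect = solve-∀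
  separate : ∀ a b → 2 * (a * b) * (2 * (a * b)) ≡ 4 * (a * a * (b * b))
  separate = solve-∀
  regroup : ∀ p q r s → 4 * (p * q * (r * s)) ≡ 4 * (p * s * (r * q))
  regroup = solve-∀
  cross : 2 * (a * b) * (2 * (a * b)) ≤ (p * s + r * q) * (p * s + r * q)
  cross = begin
    2 * (a * b) * (2 * (a * b))        ≡⟨ separate a b ⟩
    4 * (a * a * (b * b))              ≤⟨ *-monoʳ-≤ 4 (*-mono-≤ a²≤ b²≤) ⟩
    4 * (p * q * (r * s))              ≡⟨ regroup p q r s ⟩
    4 * (p * s * (r * q))              ≤⟨ am-gm (p * s) (r * q) ⟩
    (p * s + r * q) * (p * s + r * q)  ∎

-- Finite sums

∑ : {A : Set} → List A → (A → ℕ) → ℕ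
∑ xs f = sum (map f xs)

module _ {A : Set} {f g : A → ℕ} where

  ∑-cong : ∀ xs → (∀ x → f x ≡ g x) → ∑ xs f ≡ ∑ xs g
  ∑-cong []       f≡g = refl
  ∑-cong (x ∷ xs) f≡g = cong₂ _+_ (f≡g x) (∑-cong xs f≡g)

  ∑-mono : ∀ xs → (∀ x → f x ≤ g x) → ∑ xs f ≤ ∑ xs g
  ∑-mono []       f≤g = z≤n
  ∑-mono (x ∷ xs) f≤g = +-mono-≤ (f≤g x) (∑-mono xs f≤g)

  ∑-distrib-+ : ∀ xs → ∑ xs (λ x → f x + g x) ≡ ∑ xs f + ∑ xs g
  ∑-distrib-+ []       = refl
  ∑-distrib-+ (x ∷ xs) = trans (cong (f x + g x +_) (∑-distrib-+ xs)) (lemma (f x) (g x) _ _)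
    where
    lemma : ∀ a b c d → a + b + (c + d) ≡ a + c + (b + d)
    lemma = solve-∀

module _ {A : Set} where

  ∑-*ˡ : ∀ (xs : List A) c {f} → ∑ xs (λ x → c * f x) ≡ c * ∑ xs f
  ∑-*ˡ []       c     = sym (*-zeroʳ c)
  ∑-*ˡ (x ∷ xs) c {f} = trans (cong (c * f x +_) (∑-*ˡ xs c)) (sym (*-distribˡ-+ c (f x) _))

  ∑-const : ∀ (xs : List A) c → ∑ xs (λ _ → c) ≡ length xs * c
  ∑-const []       c = refl
  ∑-const (x ∷ xs) c = cong (c +_) (∑-const xs c)

  ∑-cauchy-schwarz : ∀ (xs : List A) {f p q} → (∀ x → f x * f x ≤ p x * q x) →
    ∑ xs f * ∑ xs f ≤ ∑ xs p * ∑ xs q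
  ∑-cauchy-schwarz []       f²≤ = z≤n
  ∑-cauchy-schwarz (x ∷ xs) {f} {p} {q} f²≤ =
    cauchy-schwarz₂ {f x} {∑ xs f} {p x} {q x} (f²≤ x) (∑-cauchy-schwarz xs {f} {p} {q} f²≤)

  -- Each x is matched with one occurrence in `ys`, which is then deleted; uniqueness keeps the
  -- other entries of `xs` available in what remains.
  ∑-mono-⊆ : ∀ {xs ys : List A} {f} → Unique xs → All (_∈ ys) xs → ∑ xs f ≤ ∑ ys f
  ∑-mono-⊆ [] [] = z≤n
  ∑-mono-⊆ {x ∷ xs} {ys} {f} (x∉xs ∷ uniq) (x∈ys ∷ xs⊆ys) with ∈-∃++ x∈ys
  ... | as , bs , refl = begin
    f x + ∑ xs f  ≤⟨ +-monoʳ-≤ (f x) (∑-mono-⊆ uniq xs⊆zs) ⟩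
    f x + ∑ zs f  ≡⟨ sum-↭ (map⁺ f ys↭x∷zs) ⟨
    ∑ ys f        ∎
    where
    open ≤-Reasoning
    zs = as ++ bs
    ys↭x∷zs = shift x as bs
    strengthen : ∀ {z} → x ≢ z × z ∈ ys → z ∈ zs
    strengthen (x≢z , z∈ys) with ∈-resp-↭ ys↭x∷zs z∈ys
    ... | here z≡x   = contradiction (sym z≡x) x≢z
    ... | there z∈zs = z∈zs
    xs⊆zs = All.map strengthen (All.zip (x∉xs , xs⊆ys))

∑-swap : {A B : Set} (xs : List A) (ys : List B) {f : A → B → ℕ} →
  ∑ xs (λ x → ∑ ys (f x)) ≡ ∑ ys (λ y → ∑ xs λ x → f x y)
∑-swap []       ys     = sym (trans (∑-const ys 0) (*-zeroʳ (length ys)))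
∑-swap (x ∷ xs) ys {f} = trans (cong (∑ ys (f x) +_) (∑-swap xs ys)) (sym (∑-distrib-+ ys))

-- Indicator functions on subsets: χ of disjointness, σ of inclusion, δ of equality

χ : ∀ {n} → Subset n → Subset n → ℕ
χ []            []            = 1
χ (inside ∷ x)  (inside ∷ y)  = 0
χ (inside ∷ x)  (outside ∷ y) = χ x y
χ (outside ∷ x) (_ ∷ y)       = χ x y

χ≤1 : ∀ {n} (x y : Subset n) → χ x y ≤ 1
χ≤1 []            []            = ≤-refl
χ≤1 (inside ∷ x)  (inside ∷ y)  = z≤n
χ≤1 (inside ∷ x)  (outside ∷ y) = χ≤1 x y
χ≤1 (outside ∷ x) (_ ∷ y)       = χ≤1 x y

χ-⊥ : ∀ {n} (x : Subset n) → χ x ⊥ ≡ 1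
χ-⊥ []            = refl
χ-⊥ (inside ∷ x)  = χ-⊥ x
χ-⊥ (outside ∷ x) = χ-⊥ x

χ-sym : ∀ {n} (x y : Subset n) → χ x y ≡ χ y x
χ-sym []            []            = refl
χ-sym (inside ∷ x)  (inside ∷ y)  = refl
χ-sym (inside ∷ x)  (outside ∷ y) = χ-sym x y
χ-sym (outside ∷ x) (inside ∷ y)  = χ-sym x y
χ-sym (outside ∷ x) (outside ∷ y) = χ-sym x y

χ-∪ : ∀ {n} (x y z : Subset n) → χ x (y ∪ z) ≡ χ x y * χ x z
χ-∪ []            []            []            = refl
χ-∪ (inside ∷ x)  (inside ∷ y)  (_ ∷ z)       = refl
χ-∪ (inside ∷ x)  (outside ∷ y) (inside ∷ z)  = sym (*-zeroʳ (χ x y))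
χ-∪ (inside ∷ x)  (outside ∷ y) (outside ∷ z) = χ-∪ x y z
χ-∪ (outside ∷ x) (_ ∷ y)       (_ ∷ z)       = χ-∪ x y z

disjoint⇒χ≡1 : ∀ {n} {x y : Subset n} → Disjoint x y → χ x y ≡ 1
disjoint⇒χ≡1 {x = []}          {[]}          _  = refl
disjoint⇒χ≡1 {x = inside ∷ _}  {outside ∷ _} eq = disjoint⇒χ≡1 (∷-injectiveʳ eq)
disjoint⇒χ≡1 {x = outside ∷ _} {_ ∷ _}       eq = disjoint⇒χ≡1 (∷-injectiveʳ eq)

∣∪∣-disjoint : ∀ {n} (x y : Subset n) → χ x y ≡ 1 → ∣ x ∪ y ∣ ≡ ∣ x ∣ + ∣ y ∣
∣∪∣-disjoint []            []            _  = refl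
∣∪∣-disjoint (inside ∷ x)  (outside ∷ y) eq = cong suc (∣∪∣-disjoint x y eq)
∣∪∣-disjoint (outside ∷ x) (inside ∷ y)  eq =
  trans (cong suc (∣∪∣-disjoint x y eq)) (sym (+-suc ∣ x ∣ ∣ y ∣))
∣∪∣-disjoint (outside ∷ x) (outside ∷ y) eq = ∣∪∣-disjoint x y eq

σ : ∀ {n} → Subset n → Subset n → ℕ
σ []            []            = 1
σ (inside ∷ x)  (inside ∷ y)  = σ x y
σ (inside ∷ x)  (outside ∷ y) = 0
σ (outside ∷ x) (_ ∷ y)       = σ x y

σ-⊥ : ∀ {n} (y : Subset n) → σ ⊥ y ≡ 1
σ-⊥ []      = refl
σ-⊥ (_ ∷ y) = σ-⊥ y

σ-∪ : ∀ {n} (x z y : Subset n) → σ (x ∪ z) y ≡ σ x y * σ z y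
σ-∪ []            []            []            = refl
σ-∪ (inside ∷ x)  (inside ∷ z)  (inside ∷ y)  = σ-∪ x z y
σ-∪ (inside ∷ x)  (inside ∷ z)  (outside ∷ y) = refl
σ-∪ (inside ∷ x)  (outside ∷ z) (inside ∷ y)  = σ-∪ x z y
σ-∪ (inside ∷ x)  (outside ∷ z) (outside ∷ y) = refl
σ-∪ (outside ∷ x) (inside ∷ z)  (inside ∷ y)  = σ-∪ x z y
σ-∪ (outside ∷ x) (inside ∷ z)  (outside ∷ y) = sym (*-zeroʳ (σ x y))
σ-∪ (outside ∷ x) (outside ∷ z) (_ ∷ y)       = σ-∪ x z y

δ : ∀ {n} → Subset n → Subset n → ℕ
δ []            []            = 1
δ (inside ∷ x)  (inside ∷ y)  = δ x y
δ (inside ∷ x)  (outside ∷ y) = 0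
δ (outside ∷ x) (inside ∷ y)  = 0
δ (outside ∷ x) (outside ∷ y) = δ x y

δ-refl : ∀ {n} (x : Subset n) → δ x x ≡ 1
δ-refl []            = refl
δ-refl (inside ∷ x)  = δ-refl x
δ-refl (outside ∷ x) = δ-refl x

δ≤σ : ∀ {n} (x y : Subset n) → δ x y ≤ σ x y
δ≤σ []            []            = ≤-refl
δ≤σ (inside ∷ x)  (inside ∷ y)  = δ≤σ x y
δ≤σ (inside ∷ x)  (outside ∷ y) = z≤n
δ≤σ (outside ∷ x) (inside ∷ y)  = z≤n
δ≤σ (outside ∷ x) (outside ∷ y) = δ≤σ x y

-- Enumeration of all subsets

subsets : ∀ n → List (Subset n)
subsets zero    = [] ∷ []
subsets (suc n) = map (outside ∷_) (subsets n) ++ map (inside ∷_) (subsets n)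

length-subsets : ∀ n → length (subsets n) ≡ 2 ^ n
length-subsets zero    = refl
length-subsets (suc n) = begin
  length (map (outside ∷_) (subsets n) ++ map (inside ∷_) (subsets n))
    ≡⟨ length-++ (map (outside ∷_) (subsets n)) ⟩
  length (map (outside ∷_) (subsets n)) + length (map (inside ∷_) (subsets n))
    ≡⟨ cong₂ _+_ (length-map (outside ∷_) (subsets n)) (length-map (inside ∷_) (subsets n)) ⟩
  length (subsets n) + length (subsets n)
    ≡⟨ cong (λ l → l + l) (length-subsets n) ⟩
  2 ^ n + 2 ^ n
    ≡⟨ cong (2 ^ n +_) (+-identityʳ (2 ^ n)) ⟨
  2 ^ suc n ∎
  where open ≡-Reasoning

∈-subsets : ∀ {n} (x : Subset n) → x ∈ subsets n
∈-subsets []            = here refl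
∈-subsets (inside ∷ x)  = ∈-++⁺ʳ _ (∈-map⁺ (inside ∷_) (∈-subsets x))
∈-subsets (outside ∷ x) = ∈-++⁺ˡ (∈-map⁺ (outside ∷_) (∈-subsets x))

∑-subsets-suc : ∀ n {f : Subset (suc n) → ℕ} → ∑ (subsets (suc n)) f ≡
  ∑ (subsets n) (λ x → f (outside ∷ x)) + ∑ (subsets n) (λ x → f (inside ∷ x))
∑-subsets-suc n {f} = begin
  ∑ (os ++ is) f             ≡⟨ cong sum (map-++ f os is) ⟩
  sum (map f os ++ map f is) ≡⟨ sum-++ (map f os) (map f is) ⟩
  ∑ os f + ∑ is f            ≡⟨ cong₂ (λ o i → sum o + sum i) (map-∘ (subsets n)) (map-∘ (subsets n)) ⟨
  ∑ (subsets n) (λ x → f (outside ∷ x)) + ∑ (subsets n) (λ x → f (inside ∷ x)) ∎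
  where
  open ≡-Reasoning
  os = map (outside ∷_) (subsets n)
  is = map (inside ∷_) (subsets n)

∑-σ : ∀ {n} (y : Subset n) → ∑ (subsets n) (λ x → σ x y) ≡ 2 ^ ∣ y ∣
∑-σ []                    = refl
∑-σ {suc n} (inside ∷ y)  = begin
  _                ≡⟨ ∑-subsets-suc n {λ x → σ x (inside ∷ y)} ⟩
  _                ≡⟨ cong₂ _+_ (∑-σ y) (∑-σ y) ⟩
  2 ^ ∣ y ∣ + 2 ^ ∣ y ∣  ≡⟨ cong (2 ^ ∣ y ∣ +_) (+-identityʳ (2 ^ ∣ y ∣)) ⟨
  2 ^ suc ∣ y ∣    ∎
  where open ≡-Reasoning
∑-σ {suc n} (outside ∷ y) = begin
  _                ≡⟨ ∑-subsets-suc n {λ x → σ x (outside ∷ y)} ⟩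
  _                ≡⟨ cong₂ _+_ (∑-σ y) (trans (∑-const (subsets n) 0) (*-zeroʳ (length (subsets n)))) ⟩
  2 ^ ∣ y ∣ + 0    ≡⟨ +-identityʳ _ ⟩
  2 ^ ∣ y ∣        ∎
  where open ≡-Reasoning

∑-δ : ∀ {n} (x : Subset n) {f : Subset n → ℕ} → ∑ (subsets n) (λ y → δ x y * f y) ≡ f x
∑-δ []                {f} = trans (+-identityʳ _) (+-identityʳ _)
∑-δ {suc n} (inside ∷ x)  {f} = begin
  _                  ≡⟨ ∑-subsets-suc n {λ y → δ (inside ∷ x) y * f y} ⟩
  _                  ≡⟨ cong₂ _+_ (trans (∑-const (subsets n) 0) (*-zeroʳ (length (subsets n)))) (∑-δ x) ⟩
  f (inside ∷ x)     ∎
  where open ≡-Reasoning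
∑-δ {suc n} (outside ∷ x) {f} = begin
  _                  ≡⟨ ∑-subsets-suc n {λ y → δ (outside ∷ x) y * f y} ⟩
  _                  ≡⟨ cong₂ _+_ (∑-δ x) (trans (∑-const (subsets n) 0) (*-zeroʳ (length (subsets n)))) ⟩
  f (outside ∷ x) + 0 ≡⟨ +-identityʳ _ ⟩
  f (outside ∷ x)    ∎
  where open ≡-Reasoning

-- Tuples of pairwise disjoint members and the Moon-Moser inequalities

∪-swapʳ : ∀ {n} (c x y : Subset n) → (c ∪ x) ∪ y ≡ (c ∪ y) ∪ x
∪-swapʳ c x y = begin
  (c ∪ x) ∪ y  ≡⟨ ∪-assoc c x y ⟩
  c ∪ (x ∪ y)  ≡⟨ cong (c ∪_) (∪-comm x y) ⟩
  c ∪ (y ∪ x)  ≡⟨ ∪-assoc c y x ⟨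
  (c ∪ y) ∪ x  ∎
  where open ≡-Reasoning

module Tuples {n} (V : List (Subset n)) where

  -- S s f c z sums f (z ∪ x₁ ∪ … ∪ xₛ) over the ordered s-tuples of pairwise disjoint
  -- members of V that are all disjoint from c.
  S : ℕ → (Subset n → ℕ) → Subset n → Subset n → ℕ
  S zero    f c z = f z
  S (suc s) f c z = ∑ V λ x → χ x c * S s f (c ∪ x) (z ∪ x)

  -- Counts the tuples over which `S s` sums: ordered cliques of the disjointness relation on `V`,
  -- taken among the members disjoint from `c`. The count A s is `a s ⊥`.
  a : ℕ → Subset n → ℕ
  a zero    c = 1
  a (suc s) c = ∑ V λ x → χ x c * a s (c ∪ x)

  deg : Subset n → ℕ
  deg c = ∑ V λ x → χ x c

  a-1 : ∀ c → a 1 c ≡ deg c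
  a-1 c = ∑-cong V λ x → *-identityʳ (χ x c)

  deg-⊥ : deg ⊥ ≡ length V
  deg-⊥ = trans (∑-cong V χ-⊥) (trans (∑-const V 1) (*-identityʳ (length V)))

  S-cong : ∀ s {f g} c z → (∀ u → f u ≡ g u) → S s f c z ≡ S s g c z
  S-cong zero    c z f≡g = f≡g z
  S-cong (suc s) c z f≡g = ∑-cong V λ x → cong (χ x c *_) (S-cong s (c ∪ x) (z ∪ x) f≡g)

  S-1 : ∀ s c z → S s (λ _ → 1) c z ≡ a s c
  S-1 zero    c z = refl
  S-1 (suc s) c z = ∑-cong V λ x → cong (χ x c *_) (S-1 s (c ∪ x) (z ∪ x))

  -- Once the first s members are fixed, `deg` of their union with `c` counts the choices for one
  -- more.
  S-deg : ∀ s c → S s deg c c ≡ a (suc s) c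
  S-deg zero    c = sym (a-1 c)
  S-deg (suc s) c = ∑-cong V λ x → cong (χ x c *_) (S-deg s (c ∪ x))

  a≤ : ∀ s c → a s c ≤ length V ^ s
  a≤ zero    c = ≤-refl
  a≤ (suc s) c = begin
    ∑ V (λ x → χ x c * a s (c ∪ x))  ≤⟨ ∑-mono V (λ x → *-mono-≤ (χ≤1 x c) (a≤ s (c ∪ x))) ⟩
    ∑ V (λ x → 1 * length V ^ s)     ≡⟨ ∑-const V _ ⟩
    length V * (1 * length V ^ s)    ≡⟨ cong (length V *_) (*-identityˡ _) ⟩
    length V ^ suc s                 ∎
    where open ≤-Reasoning

  -- Double counting: the extra set x only has to avoid the sets that f sees.
  S-extend : ∀ s {f} c u →
    ∑ V (λ x → χ x u * S s f (c ∪ x) u) ≡ S s (λ z → deg z * f z) c u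
  S-extend zero    {f} c u = begin
    ∑ V (λ x → χ x u * f u)  ≡⟨ ∑-cong V (λ x → *-comm (χ x u) (f u)) ⟩
    ∑ V (λ x → f u * χ x u)  ≡⟨ ∑-*ˡ V (f u) ⟩
    f u * deg u              ≡⟨ *-comm (f u) (deg u) ⟩
    deg u * f u              ∎
    where open ≡-Reasoning
  S-extend (suc s) {f} c u = begin
    ∑ V (λ x → χ x u * ∑ V (λ y → χ y (c ∪ x) * S s f ((c ∪ x) ∪ y) (u ∪ y)))
      ≡⟨ ∑-cong V (λ x → ∑-*ˡ V (χ x u)) ⟨
    ∑ V (λ x → ∑ V (λ y → χ x u * (χ y (c ∪ x) * S s f ((c ∪ x) ∪ y) (u ∪ y))))
      ≡⟨ ∑-swap V V ⟩
    ∑ V (λ y → ∑ V (λ x → χ x u * (χ y (c ∪ x) * S s f ((c ∪ x) ∪ y) (u ∪ y))))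
      ≡⟨ ∑-cong V (λ y → trans (∑-cong V (λ x → exchange x y)) (∑-*ˡ V (χ y c))) ⟩
    ∑ V (λ y → χ y c * ∑ V (λ x → χ x (u ∪ y) * S s f ((c ∪ y) ∪ x) (u ∪ y)))
      ≡⟨ ∑-cong V (λ y → cong (χ y c *_) (S-extend s (c ∪ y) (u ∪ y))) ⟩
    S (suc s) (λ z → deg z * f z) c u ∎
    where
    open ≡-Reasoning
    lemma : ∀ p q r t → p * (q * r * t) ≡ q * (p * r * t)
    lemma = solve-∀
    exchange : ∀ x y → χ x u * (χ y (c ∪ x) * S s f ((c ∪ x) ∪ y) (u ∪ y)) ≡
      χ y c * (χ x (u ∪ y) * S s f ((c ∪ y) ∪ x) (u ∪ y))
    exchange x y rewrite ∪-swapʳ c x y | χ-∪ y c x | χ-∪ x u y | χ-sym y x =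
      lemma (χ x u) (χ y c) (χ x y) (S s f ((c ∪ y) ∪ x) (u ∪ y))

  -- Cauchy-Schwarz against the constant function 1, whose sum over these tuples is `a s c`.
  S-cauchy-schwarz : ∀ s f c z →
    S s f c z * S s f c z ≤ a s c * S s (λ u → f u * f u) c z
  S-cauchy-schwarz zero    f c z = ≤-reflexive (sym (*-identityˡ _))
  S-cauchy-schwarz (suc s) f c z = ∑-cauchy-schwarz V λ x → begin
    χ x c * T x * (χ x c * T x)                      ≡⟨ lemma (χ x c) (T x) (χ x c) (T x) ⟩
    χ x c * χ x c * (T x * T x)                      ≤⟨ *-monoʳ-≤ (χ x c * χ x c) (S-cauchy-schwarz s f (c ∪ x) (z ∪ x)) ⟩
    χ x c * χ x c * (a s (c ∪ x) * T² x)             ≡⟨ lemma (χ x c) (a s (c ∪ x)) (χ x c) (T² x) ⟨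
    χ x c * a s (c ∪ x) * (χ x c * T² x)             ∎
    where
    open ≤-Reasoning
    T T² : Subset n → ℕ
    T  x = S s f (c ∪ x) (z ∪ x)
    T² x = S s (λ u → f u * f u) (c ∪ x) (z ∪ x)
    lemma : ∀ p q r t → p * q * (r * t) ≡ p * r * (q * t)
    lemma = solve-∀

  -- Holds for each member w separately: if p and r are the 0/1 values of being disjoint from x and
  -- from y, it is p + r ≤ 1 + pr times the indicator of being disjoint from u.
  deg-submodular : ∀ u x y → deg (u ∪ x) + deg (u ∪ y) ≤ deg u + deg ((u ∪ y) ∪ x)
  deg-submodular u x y = begin
    deg (u ∪ x) + deg (u ∪ y)                      ≡⟨ ∑-distrib-+ V ⟨
    ∑ V (λ w → χ w (u ∪ x) + χ w (u ∪ y))          ≤⟨ ∑-mono V pointwise ⟩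
    ∑ V (λ w → χ w u + χ w ((u ∪ y) ∪ x))          ≡⟨ ∑-distrib-+ V ⟩
    deg u + deg ((u ∪ y) ∪ x)                      ∎
    where
    open ≤-Reasoning
    bits : ∀ {p} q r → p ≤ 1 → r ≤ 1 → q * p + q * r ≤ q + q * r * p
    bits q r z≤n r≤1
      rewrite *-zeroʳ q | *-zeroʳ (q * r) | +-identityʳ q =
      subst (q * r ≤_) (*-identityʳ q) (*-monoʳ-≤ q r≤1)
    bits q r (s≤s z≤n) r≤1 rewrite *-identityʳ q | *-identityʳ (q * r) = ≤-refl
    pointwise : ∀ w → χ w (u ∪ x) + χ w (u ∪ y) ≤ χ w u + χ w ((u ∪ y) ∪ x)
    pointwise w rewrite χ-∪ w (u ∪ y) x | χ-∪ w u x | χ-∪ w u y =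
      bits (χ w u) (χ w y) (χ≤1 w x) (χ≤1 w y)

  -- The loss in `deg` caused by adjoining x can only shrink as u grows, so the hypothesis persists
  -- when an s-tuple is adjoined to u; the conclusion sums it over all such tuples. General p and q
  -- let it pass through the induction without subtraction.
  S-deg-bound : ∀ s p q u x → p + deg u ≤ q + deg (u ∪ x) →
    p * a s (u ∪ x) + S s deg (u ∪ x) u ≤ q * a s (u ∪ x) + a (suc s) (u ∪ x)
  S-deg-bound zero    p q u x p≤q = begin
    p * 1 + deg u             ≡⟨ cong (_+ deg u) (*-identityʳ p) ⟩
    p + deg u                 ≤⟨ p≤q ⟩
    q + deg (u ∪ x)           ≡⟨ cong₂ _+_ (*-identityʳ q) (a-1 (u ∪ x)) ⟨
    q * 1 + a 1 (u ∪ x)       ∎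
    where open ≤-Reasoning
  S-deg-bound (suc s) p q u x p≤q = begin
    p * a (suc s) w + S (suc s) deg w u
      ≡⟨ factor p (λ y → S s deg (w ∪ y) (u ∪ y)) ⟩
    ∑ V (λ y → χ y w * (p * a s (w ∪ y) + S s deg (w ∪ y) (u ∪ y)))
      ≤⟨ ∑-mono V (λ y → *-monoʳ-≤ (χ y w) (pointwise y)) ⟩
    ∑ V (λ y → χ y w * (q * a s (w ∪ y) + a (suc s) (w ∪ y)))
      ≡⟨ factor q (λ y → a (suc s) (w ∪ y)) ⟨
    q * a (suc s) w + a (suc (suc s)) w ∎
    where
    open ≤-Reasoning
    w = u ∪ x
    lemma : ∀ p χ a t → p * (χ * a) + χ * t ≡ χ * (p * a + t)
    lemma = solve-∀
    factor : ∀ p t → p * a (suc s) w + ∑ V (λ y → χ y w * t y) ≡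
      ∑ V (λ y → χ y w * (p * a s (w ∪ y) + t y))
    factor p t = begin-equality
      p * a (suc s) w + ∑ V (λ y → χ y w * t y)
        ≡⟨ cong (_+ ∑ V (λ y → χ y w * t y)) (∑-*ˡ V p) ⟨
      ∑ V (λ y → p * (χ y w * a s (w ∪ y))) + ∑ V (λ y → χ y w * t y)
        ≡⟨ ∑-distrib-+ V ⟨
      ∑ V (λ y → p * (χ y w * a s (w ∪ y)) + χ y w * t y)
        ≡⟨ ∑-cong V (λ y → lemma p (χ y w) (a s (w ∪ y)) (t y)) ⟩
      ∑ V (λ y → χ y w * (p * a s (w ∪ y) + t y)) ∎
    pointwise : ∀ y → p * a s (w ∪ y) + S s deg (w ∪ y) (u ∪ y) ≤ q * a s (w ∪ y) + a (suc s) (w ∪ y)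
    pointwise y rewrite ∪-swapʳ u x y = S-deg-bound s p q (u ∪ y) x
      (exchange (deg-submodular u x y))
      where
      exchange : ∀ {e f} → deg w + e ≤ deg u + f → p + e ≤ q + f
      exchange {e} {f} h = +-cancelˡ-≤ (deg u + deg w) _ _ (begin
        deg u + deg w + (p + e)   ≡⟨ lem (deg u) (deg w) p e ⟩
        (p + deg u) + (deg w + e) ≤⟨ +-mono-≤ p≤q h ⟩
        (q + deg w) + (deg u + f) ≡⟨ lem′ (deg u) (deg w) q f ⟩
        deg u + deg w + (q + f)   ∎)
        where
        lem : ∀ u w p e → u + w + (p + e) ≡ p + u + (w + e)
        lem = solve-∀
        lem′ : ∀ u w q f → q + w + (u + f) ≡ u + w + (q + f)
        lem′ = solve-∀

  -- Induction on s. One copy of the sum of squared degrees is rewritten by `S-extend` as a choice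
  -- of an extra x and a tuple avoiding it; the other copies are split by their first member x and
  -- use the induction hypothesis at u ∪ x. For each x, `S-deg-bound` then trades the degree of u ∪
  -- x for that of u.
  moon-moser : ∀ s u →
    suc s * S s (λ z → deg z * deg z) u u ≤ deg u * a (suc s) u + s * a (suc (suc s)) u
  moon-moser zero    u = ≤-reflexive (trans (+-identityʳ _)
    (trans (cong (deg u *_) (sym (a-1 u))) (sym (+-identityʳ _))))
  moon-moser (suc s) u = begin
    S (suc s) deg² u u + suc s * S (suc s) deg² u u
      ≡⟨ cong₂ _+_ (S-extend (suc s) u u) (∑-*ˡ V (suc s)) ⟨
    ∑ V (λ x → χ x u * S (suc s) deg (u ∪ x) u) +
      ∑ V (λ x → suc s * (χ x u * S s deg² (u ∪ x) (u ∪ x)))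
      ≡⟨ ∑-distrib-+ V ⟨
    ∑ V (λ x → χ x u * S (suc s) deg (u ∪ x) u + suc s * (χ x u * S s deg² (u ∪ x) (u ∪ x)))
      ≤⟨ ∑-mono V pointwise ⟩
    ∑ V (λ x → deg u * (χ x u * a (suc s) (u ∪ x)) + suc s * (χ x u * a (suc (suc s)) (u ∪ x)))
      ≡⟨ ∑-distrib-+ V ⟩
    ∑ V (λ x → deg u * (χ x u * a (suc s) (u ∪ x))) +
      ∑ V (λ x → suc s * (χ x u * a (suc (suc s)) (u ∪ x)))
      ≡⟨ cong₂ _+_ (∑-*ˡ V (deg u)) (∑-*ˡ V (suc s)) ⟩
    deg u * a (suc (suc s)) u + suc s * a (suc (suc (suc s))) u ∎
    where
    open ≤-Reasoning
    deg² : Subset n → ℕ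
    deg² z = deg z * deg z
    lemma₁ : ∀ c p k q → c * p + k * (c * q) ≡ c * (p + k * q)
    lemma₁ = solve-∀
    lemma₂ : ∀ p q s r → p + (q + s * r) ≡ q + p + s * r
    lemma₂ = solve-∀
    lemma₃ : ∀ c d p q s → c * (d * p + q + s * q) ≡ d * (c * p) + (1 + s) * (c * q)
    lemma₃ = solve-∀
    pointwise : ∀ x →
      χ x u * S (suc s) deg (u ∪ x) u + suc s * (χ x u * S s deg² (u ∪ x) (u ∪ x)) ≤
      deg u * (χ x u * a (suc s) (u ∪ x)) + suc s * (χ x u * a (suc (suc s)) (u ∪ x))
    pointwise x = begin
      χ x u * E + suc s * (χ x u * Q)   ≡⟨ lemma₁ (χ x u) E (suc s) Q ⟩
      χ x u * (E + suc s * Q)           ≤⟨ *-monoʳ-≤ (χ x u) (+-monoʳ-≤ E (moon-moser s w)) ⟩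
      χ x u * (E + (deg w * A + s * B)) ≡⟨ cong (χ x u *_) (lemma₂ E (deg w * A) s B) ⟩
      χ x u * (deg w * A + E + s * B)   ≤⟨ *-monoʳ-≤ (χ x u) (+-monoˡ-≤ (s * B)
                                            (S-deg-bound (suc s) (deg w) (deg u) u x
                                              (≤-reflexive (+-comm (deg w) (deg u))))) ⟩
      χ x u * (deg u * A + B + s * B)   ≡⟨ lemma₃ (χ x u) (deg u) A B s ⟩
      deg u * (χ x u * A) + suc s * (χ x u * B) ∎
      where
      w = u ∪ x
      E = S (suc s) deg w u
      Q = S s deg² w w
      A = a (suc s) w
      B = a (suc (suc s)) w

  -- A (s+1) is the sum of `deg` over s-tuples; Cauchy-Schwarz bounds its square by A s times the
  -- sum of squared degrees, to which `moon-moser` applies.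
  clique-count-log-convexity : ∀ s → let A = λ i → a i ⊥ in
    suc s * (A (suc s) * A (suc s)) ≤ A s * (length V * A (suc s) + s * A (suc (suc s)))
  clique-count-log-convexity s = begin
    suc s * (a (suc s) ⊥ * a (suc s) ⊥)
      ≡⟨ cong (λ t → suc s * (t * t)) (S-deg s ⊥) ⟨
    suc s * (S s deg ⊥ ⊥ * S s deg ⊥ ⊥)
      ≤⟨ *-monoʳ-≤ (suc s) (S-cauchy-schwarz s deg ⊥ ⊥) ⟩
    suc s * (a s ⊥ * S s (λ z → deg z * deg z) ⊥ ⊥)
      ≡⟨ lemma (suc s) (a s ⊥) _ ⟩
    a s ⊥ * (suc s * S s (λ z → deg z * deg z) ⊥ ⊥)
      ≤⟨ *-monoʳ-≤ (a s ⊥) (moon-moser s ⊥) ⟩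
    a s ⊥ * (deg ⊥ * a (suc s) ⊥ + s * a (suc (suc s)) ⊥)
      ≡⟨ cong (λ m → a s ⊥ * (m * a (suc s) ⊥ + s * a (suc (suc s)) ⊥)) deg-⊥ ⟩
    a s ⊥ * (length V * a (suc s) ⊥ + s * a (suc (suc s)) ⊥) ∎
    where
    open ≤-Reasoning
    lemma : ∀ p q r → p * (q * r) ≡ q * (p * r)
    lemma = solve-∀

-- Tuples that may overlap: exchange of sums, union bound, power mean

^-2^-suc : ∀ x j → x ^ (2 ^ suc j) ≡ x ^ (2 ^ j) * x ^ (2 ^ j)
^-2^-suc x j = trans (cong (λ e → x ^ (2 ^ j + e)) (+-identityʳ (2 ^ j)))
                     (^-distribˡ-+-* x (2 ^ j) (2 ^ j))

module IndependentTuples {n} (V : List (Subset n)) where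

  open Tuples V

  -- R t g u w sums g (w ∪ x₁ ∪ … ∪ xₜ) over all t-tuples of members of V disjoint from u;
  -- the xᵢ may overlap.
  R : ℕ → (Subset n → ℕ) → Subset n → Subset n → ℕ
  R zero    g u w = g w
  R (suc t) g u w = ∑ V λ x → χ x u * R t g u (w ∪ x)

  -- The two choices are interchanged: given the s-tuple, and z its union with u, each of the t
  -- members ranges independently over the `deg z` members disjoint from z.
  R-a : ∀ t s u w → R t (λ v → a s (u ∪ v)) u w ≡ S s (λ z → deg z ^ t) (u ∪ w) u
  R-a zero    s u w = sym (S-1 s (u ∪ w) u)
  R-a (suc t) s u w = begin
    ∑ V (λ x → χ x u * R t (λ v → a s (u ∪ v)) u (w ∪ x))
      ≡⟨ ∑-cong V (λ x → cong (χ x u *_) (R-a t s u (w ∪ x))) ⟩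
    ∑ V (λ x → χ x u * S s (λ z → deg z ^ t) (u ∪ (w ∪ x)) u)
      ≡⟨ ∑-cong V (λ x → cong (λ c → χ x u * S s (λ z → deg z ^ t) c u) (∪-assoc u w x)) ⟨
    ∑ V (λ x → χ x u * S s (λ z → deg z ^ t) ((u ∪ w) ∪ x) u)
      ≡⟨ S-extend s (u ∪ w) u ⟩
    S s (λ z → deg z ^ suc t) (u ∪ w) u ∎
    where open ≡-Reasoning

  R-*ˡ : ∀ t d {g} u w → R t (λ v → d * g v) u w ≡ d * R t g u w
  R-*ˡ zero    d     u w = refl
  R-*ˡ (suc t) d {g} u w = begin
    ∑ V (λ x → χ x u * R t (λ v → d * g v) u (w ∪ x))
      ≡⟨ ∑-cong V (λ x → trans (cong (χ x u *_) (R-*ˡ t d u (w ∪ x))) (lemma (χ x u) d _)) ⟩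
    ∑ V (λ x → d * (χ x u * R t g u (w ∪ x)))
      ≡⟨ ∑-*ˡ V d ⟩
    d * R (suc t) g u w ∎
    where
    open ≡-Reasoning
    lemma : ∀ p q r → p * (q * r) ≡ q * (p * r)
    lemma = solve-∀

  R-mono : ∀ t {g h} u w → (∀ v → χ u v ≡ 1 → g v ≤ h v) → χ u w ≡ 1 → R t g u w ≤ R t h u w
  R-mono zero    u w g≤h u∥w = g≤h w u∥w
  R-mono (suc t) {g} {h} u w g≤h u∥w = ∑-mono V pointwise
    where
    pointwise : ∀ x → χ x u * R t g u (w ∪ x) ≤ χ x u * R t h u (w ∪ x)
    pointwise x with n≤1⇒n≡0∨n≡1 (χ≤1 x u)
    ... | inj₁ ≡0 rewrite ≡0 = z≤n
    ... | inj₂ ≡1 = *-monoʳ-≤ (χ x u) (R-mono t u (w ∪ x) g≤h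
      (trans (χ-∪ u w x) (cong₂ _*_ u∥w (trans (χ-sym u x) ≡1))))

  R-affine : ∀ t c d {h} u w → R t (λ v → c + d * h v) u w ≤ length V ^ t * c + d * R t h u w
  R-affine zero    c d     u w = ≤-reflexive (cong (_+ _) (sym (*-identityˡ c)))
  R-affine (suc t) c d {h} u w = begin
    ∑ V (λ x → χ x u * R t (λ v → c + d * h v) u (w ∪ x))
      ≤⟨ ∑-mono V pointwise ⟩
    ∑ V (λ x → length V ^ t * c + d * (χ x u * R t h u (w ∪ x)))
      ≡⟨ ∑-distrib-+ V ⟩
    ∑ V (λ x → length V ^ t * c) + ∑ V (λ x → d * (χ x u * R t h u (w ∪ x)))
      ≡⟨ cong₂ _+_ (trans (∑-const V _) (sym (*-assoc (length V) (length V ^ t) c))) (∑-*ˡ V d) ⟩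
    length V ^ suc t * c + d * R (suc t) h u w ∎
    where
    open ≤-Reasoning
    lemma : ∀ p q r s → p * (q + r * s) ≡ p * q + r * (p * s)
    lemma = solve-∀
    pointwise : ∀ x → χ x u * R t (λ v → c + d * h v) u (w ∪ x) ≤
      length V ^ t * c + d * (χ x u * R t h u (w ∪ x))
    pointwise x = begin
      χ x u * R t (λ v → c + d * h v) u (w ∪ x)
        ≤⟨ *-monoʳ-≤ (χ x u) (R-affine t c d u (w ∪ x)) ⟩
      χ x u * (length V ^ t * c + d * R t h u (w ∪ x))
        ≡⟨ lemma (χ x u) (length V ^ t * c) d _ ⟩
      χ x u * (length V ^ t * c) + d * (χ x u * R t h u (w ∪ x))
        ≤⟨ +-monoˡ-≤ _ (≤-trans (*-monoˡ-≤ _ (χ≤1 x u)) (≤-reflexive (*-identityˡ _))) ⟩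
      length V ^ t * c + d * (χ x u * R t h u (w ∪ x)) ∎

  below : Subset n → ℕ
  below y = ∑ V λ x → σ x y

  below≤ : Unique V → ∀ y → below y ≤ 2 ^ ∣ y ∣
  below≤ uniq y = subst (below y ≤_) (∑-σ y) (∑-mono-⊆ uniq (All.tabulate (λ {x} _ → ∈-subsets x)))

  -- Tuples are sorted by their final union y: all t members lie inside y, so at most `below y ^ t`
  -- tuples lead to a given y.
  R-union-bound : ∀ t g u w → R t g u w ≤ ∑ (subsets n) (λ y → σ w y * (g y * below y ^ t))
  R-union-bound zero    g u w = begin
    g w                                          ≡⟨ ∑-δ w ⟨
    ∑ (subsets n) (λ y → δ w y * g y)            ≤⟨ ∑-mono (subsets n) (λ y → *-mono-≤ (δ≤σ w y)
                                                       (≤-reflexive (sym (*-identityʳ (g y))))) ⟩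
    ∑ (subsets n) (λ y → σ w y * (g y * 1))      ∎
    where open ≤-Reasoning
  R-union-bound (suc t) g u w = begin
    ∑ V (λ x → χ x u * R t g u (w ∪ x))
      ≤⟨ ∑-mono V (λ x → ≤-trans (*-monoˡ-≤ _ (χ≤1 x u))
           (≤-trans (≤-reflexive (*-identityˡ _)) (R-union-bound t g u (w ∪ x)))) ⟩
    ∑ V (λ x → ∑ (subsets n) (λ y → σ (w ∪ x) y * (g y * below y ^ t)))
      ≡⟨ ∑-swap V (subsets n) ⟩
    ∑ (subsets n) (λ y → ∑ V (λ x → σ (w ∪ x) y * (g y * below y ^ t)))
      ≡⟨ ∑-cong (subsets n) (λ y → trans (∑-cong V (pointwise y))
           (trans (∑-*ˡ V (σ w y * (g y * below y ^ t))) (lemma₂ (σ w y) (g y) (below y ^ t) (below y)))) ⟩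
    ∑ (subsets n) (λ y → σ w y * (g y * below y ^ suc t)) ∎
    where
    open ≤-Reasoning
    lemma₁ : ∀ p q r → p * q * r ≡ p * r * q
    lemma₁ = solve-∀
    lemma₂ : ∀ p q r s → p * (q * r) * s ≡ p * (q * (s * r))
    lemma₂ = solve-∀
    pointwise : ∀ y x → σ (w ∪ x) y * (g y * below y ^ t) ≡ σ w y * (g y * below y ^ t) * σ x y
    pointwise y x rewrite σ-∪ w x y = lemma₁ (σ w y) (σ x y) _

  -- Cauchy-Schwarz iterated j times, hence the exponents 2^j, with the number of s-tuples replaced
  -- by its upper bound m^s.
  S-power-mean : ∀ .{{_ : NonZero (length V)}} s j f c z → let m^s = length V ^ s; t = 2 ^ j in
    m^s * S s f c z ^ t ≤ m^s ^ t * S s (λ u → f u ^ t) c z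
  S-power-mean s zero    f c z = ≤-reflexive (cong₂ _*_ (sym (^-identityʳ (length V ^ s)))
    (trans (^-identityʳ _) (S-cong s c z (λ u → sym (^-identityʳ (f u))))))
  S-power-mean s (suc j) f c z = *-cancelˡ-≤ M {{m^n≢0 (length V) s}} (begin
    M * (M * X ^ (2 ^ suc j))          ≡⟨ cong (λ e → M * (M * e)) (^-2^-suc X j) ⟩
    M * (M * (X ^ t * X ^ t))          ≡⟨ square M (X ^ t) ⟩
    M * X ^ t * (M * X ^ t)            ≤⟨ *-mono-≤ (S-power-mean s j f c z) (S-power-mean s j f c z) ⟩
    M ^ t * Y * (M ^ t * Y)            ≡⟨ split (M ^ t) Y ⟩
    M ^ t * M ^ t * (Y * Y)            ≤⟨ *-monoʳ-≤ (M ^ t * M ^ t) (S-cauchy-schwarz s (λ u → f u ^ t) c z) ⟩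
    M ^ t * M ^ t * (a s c * Y²)       ≤⟨ *-monoʳ-≤ (M ^ t * M ^ t) (*-monoˡ-≤ Y² (a≤ s c)) ⟩
    M ^ t * M ^ t * (M * Y²)           ≡⟨ rotate (M ^ t * M ^ t) M Y² ⟩
    M * (M ^ t * M ^ t * Y²)           ≡⟨ cong₂ (λ e y → M * (e * y)) (^-2^-suc M j)
                                            (S-cong s c z (λ u → ^-2^-suc (f u) j)) ⟨
    M * (M ^ (2 ^ suc j) * S s (λ u → f u ^ (2 ^ suc j)) c z) ∎)
    where
    open ≤-Reasoning
    M = length V ^ s
    t = 2 ^ j
    X = S s f c z
    Y = S s (λ u → f u ^ t) c z
    Y² = S s (λ u → f u ^ t * f u ^ t) c z
    square : ∀ m x → m * (m * (x * x)) ≡ m * x * (m * x)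
    square = solve-∀
    split : ∀ p y → p * y * (p * y) ≡ p * p * (y * y)
    split = solve-∀
    rotate : ∀ p q r → p * (q * r) ≡ q * (p * r)
    rotate = solve-∀

-- The density lemma

light : ℕ → ∀ {n} → Subset n → ℕ
light k {n} w with suc k * ∣ w ∣ ≤? n
... | yes _ = 1
... | no  _ = 0

module _ {n} (V : List (Subset n)) (uniq : Unique V) .{{_ : NonZero (length V)}} where

  open Tuples V
  open IndependentTuples V

  private m = length V

  -- By convexity some t members avoiding u have a union v such that a proportion of at least 1/Y of
  -- the s-tuples avoid u ∪ v. By `tail`, light v are too rare to account for this, so v can be
  -- taken heavy, and `ih` at u ∪ v gives the bound. The proof compares sums instead of choosing v.
  density-step : ∀ k j s P u → let t = 2 ^ j; Y = suc (2 * P ^ t) in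
    (∀ l → suc k * l ≤ n → 2 ^ n * (Y * (2 ^ l) ^ t) ≤ m ^ t) →
    (∀ v → m ^ s ≤ Y * a s v → s * suc n + suc k * ∣ v ∣ ≤ suc k * n) →
    m ^ suc s ≤ P * a (suc s) u → suc s * suc n + suc k * ∣ u ∣ ≤ suc k * n
  density-step k j s P u tail ih dense = ≮⇒≥ λ big → <-irrefl refl (absurd big)
    where
    open ≤-Reasoning
    t = 2 ^ j
    Y = suc (2 * P ^ t)
    M = m ^ s
    X = a (suc s) u
    Z = M * (m * M) ^ t

    -- There are at most 2^n light sets y, each containing at most 2^∣y∣ members of `V`; `tail`
    -- controls every term.
    light-count : Y * R t (light k) u ⊥ ≤ m ^ t
    light-count = *-cancelˡ-≤ (2 ^ n) {{m^n≢0 2 n}} (begin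
      2 ^ n * (Y * R t (light k) u ⊥)
        ≤⟨ *-monoʳ-≤ (2 ^ n) (*-monoʳ-≤ Y (R-union-bound t (light k) u ⊥)) ⟩
      2 ^ n * (Y * ∑ (subsets n) (λ y → σ ⊥ y * (light k y * below y ^ t)))
        ≡⟨ *-assoc (2 ^ n) Y _ ⟨
      2 ^ n * Y * ∑ (subsets n) (λ y → σ ⊥ y * (light k y * below y ^ t))
        ≡⟨ ∑-*ˡ (subsets n) (2 ^ n * Y) ⟨
      ∑ (subsets n) (λ y → 2 ^ n * Y * (σ ⊥ y * (light k y * below y ^ t)))
        ≤⟨ ∑-mono (subsets n) pointwise ⟩
      ∑ (subsets n) (λ y → m ^ t)
        ≡⟨ trans (∑-const (subsets n) (m ^ t)) (cong (_* m ^ t) (length-subsets n)) ⟩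
      2 ^ n * m ^ t ∎)
      where
      pointwise : ∀ y → 2 ^ n * Y * (σ ⊥ y * (light k y * below y ^ t)) ≤ m ^ t
      pointwise y rewrite σ-⊥ y with suc k * ∣ y ∣ ≤? n
      ... | no  _     = subst (_≤ m ^ t) (sym (*-zeroʳ (2 ^ n * Y))) z≤n
      ... | yes small = begin
        2 ^ n * Y * (1 * (1 * below y ^ t))  ≡⟨ cong (2 ^ n * Y *_) (trans (*-identityˡ _) (*-identityˡ _)) ⟩
        2 ^ n * Y * below y ^ t              ≤⟨ *-monoʳ-≤ (2 ^ n * Y) (^-monoˡ-≤ t (below≤ uniq y)) ⟩
        2 ^ n * Y * (2 ^ ∣ y ∣) ^ t          ≡⟨ *-assoc (2 ^ n) Y _ ⟩
        2 ^ n * (Y * (2 ^ ∣ y ∣) ^ t)        ≤⟨ tail ∣ y ∣ small ⟩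
        m ^ t                                ∎

    -- Convexity gives Z ≤ P^t M^t T, and summing the pointwise bound gives Y T ≤ 2 m^t M. Hence Y Z
    -- ≤ 2 P^t Z, which the summand 1 in Y = 1 + 2 P^t excludes.
    absurd : suc k * n < suc s * suc n + suc k * ∣ u ∣ → Z < Z
    absurd big = +-cancelʳ-< (2 * P ^ t * Z) Z Z (begin-strict
      Y * Z                                    ≤⟨ *-monoʳ-≤ Y (*-monoʳ-≤ M (^-monoˡ-≤ t dense)) ⟩
      Y * (M * (P * X) ^ t)                    ≡⟨ cong (λ e → Y * (M * e)) (^-distribʳ-* t P X) ⟩
      Y * (M * (P ^ t * X ^ t))                ≡⟨ move₁ Y M (P ^ t) (X ^ t) ⟩
      Y * (P ^ t * (M * X ^ t))                ≤⟨ *-monoʳ-≤ Y (*-monoʳ-≤ (P ^ t) power-mean) ⟩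
      Y * (P ^ t * (M ^ t * T))                ≡⟨ move₂ Y (P ^ t) (M ^ t) T ⟩
      P ^ t * M ^ t * (Y * T)                  ≤⟨ *-monoʳ-≤ (P ^ t * M ^ t) tuple-bound ⟩
      P ^ t * M ^ t * (m ^ t * M + M * m ^ t)  ≡⟨ move₃ (P ^ t) (M ^ t) (m ^ t) M ⟩
      2 * P ^ t * (M * (m ^ t * M ^ t))        ≡⟨ cong (λ e → 2 * P ^ t * (M * e)) (^-distribʳ-* t m M) ⟨
      2 * P ^ t * Z                            <⟨ m<n+m (2 * P ^ t * Z) Z>0 ⟩
      Z + 2 * P ^ t * Z ∎)
      where
      T = R t (λ v → a s (u ∪ v)) u ⊥
      Z>0 : 0 < Z
      Z>0 = *-mono-≤ (m^n>0 m s) (>-nonZero⁻¹ _ {{m^n≢0 (m * M) t {{m*n≢0 m M {{it}} {{m^n≢0 m s}}}}}})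
      move₁ : ∀ p q r s → p * (q * (r * s)) ≡ p * (r * (q * s))
      move₁ = solve-∀
      move₂ : ∀ p q r s → p * (q * (r * s)) ≡ q * r * (p * s)
      move₂ = solve-∀
      move₃ : ∀ p q r s → p * q * (r * s + s * r) ≡ 2 * p * (s * (r * q))
      move₃ = solve-∀
      power-mean : M * X ^ t ≤ M ^ t * T
      power-mean = begin
        M * X ^ t                               ≡⟨ cong (λ x → M * x ^ t) (S-deg s u) ⟨
        M * S s deg u u ^ t                     ≤⟨ S-power-mean s j deg u u ⟩
        M ^ t * S s (λ z → deg z ^ t) u u       ≡⟨ cong (λ c → M ^ t * S s (λ z → deg z ^ t) c u) (∪-identityʳ u) ⟨
        M ^ t * S s (λ z → deg z ^ t) (u ∪ ⊥) u ≡⟨ cong (M ^ t *_) (R-a t s u ⊥) ⟨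
        M ^ t * T                               ∎
      pointwise : ∀ v → χ u v ≡ 1 → Y * a s (u ∪ v) ≤ M + Y * M * light k v
      pointwise v u∥v with suc k * ∣ v ∣ ≤? n
      ... | yes _ = begin
        Y * a s (u ∪ v)    ≤⟨ *-monoʳ-≤ Y (a≤ s (u ∪ v)) ⟩
        Y * M              ≡⟨ *-identityʳ (Y * M) ⟨
        Y * M * 1          ≤⟨ m≤n+m _ M ⟩
        M + Y * M * 1      ∎
      -- For heavy v, more than M / Y tuples would make `ih` at u ∪ v contradict `big`: heaviness
      -- means (k+1)∣v∣ ≥ n + 1, which supplies the missing `suc n`.
      ... | no heavy = ≤-trans (≮⇒≥ λ M<Ya → <⇒≱ big (begin
        suc s * suc n + suc k * ∣ u ∣                   ≡⟨ regroup (suc n) s (suc k * ∣ u ∣) ⟩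
        s * suc n + (suc k * ∣ u ∣ + suc n)             ≤⟨ +-monoʳ-≤ (s * suc n) (+-monoʳ-≤ (suc k * ∣ u ∣) (≰⇒> heavy)) ⟩
        s * suc n + (suc k * ∣ u ∣ + suc k * ∣ v ∣)     ≡⟨ cong (s * suc n +_) (*-distribˡ-+ (suc k) ∣ u ∣ ∣ v ∣) ⟨
        s * suc n + suc k * (∣ u ∣ + ∣ v ∣)             ≡⟨ cong (λ l → s * suc n + suc k * l) (∣∪∣-disjoint u v u∥v) ⟨
        s * suc n + suc k * ∣ u ∪ v ∣                   ≤⟨ ih (u ∪ v) (<⇒≤ M<Ya) ⟩
        suc k * n                                       ∎)) (m≤m+n M _)
        where
        regroup : ∀ p s q → (1 + s) * p + q ≡ s * p + (q + p)
        regroup = solve-∀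
      tuple-bound : Y * T ≤ m ^ t * M + M * m ^ t
      tuple-bound = begin
        Y * T                                            ≡⟨ R-*ˡ t Y u ⊥ ⟨
        R t (λ v → Y * a s (u ∪ v)) u ⊥                  ≤⟨ R-mono t u ⊥ pointwise (χ-⊥ u) ⟩
        R t (λ v → M + Y * M * light k v) u ⊥            ≤⟨ R-affine t M (Y * M) u ⊥ ⟩
        m ^ t * M + Y * M * R t (light k) u ⊥            ≡⟨ cong (m ^ t * M +_) (move₄ Y M _) ⟩
        m ^ t * M + M * (Y * R t (light k) u ⊥)          ≤⟨ +-monoʳ-≤ (m ^ t * M) (*-monoʳ-≤ M light-count) ⟩
        m ^ t * M + M * m ^ t                            ∎
        where
        move₄ : ∀ p q r → p * q * r ≡ q * (p * r)
        move₄ = solve-∀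

-- Up to constants m ≥ 2^(n/k) and 2^l ≤ 2^(n/(k+1)), so (m / 2^l)^t is about 2^(nt/c) or more,
-- because 1/k - 1/(k+1) = 1/c. As t > c, there is room beyond 2^n to absorb Y and the constants.
-- Raising to the power c clears the denominators.
union-bound-tail : ∀ k .{{_ : NonZero k}} t Y m n → let c = k * suc k in
  suc c ≤ t → suc k * t + Y * c ≤ n → 2 ^ n ≤ 2 * m ^ k →
  ∀ l → suc k * l ≤ n → 2 ^ n * (Y * (2 ^ l) ^ t) ≤ m ^ t
union-bound-tail k t Y m n c<t n₀≤n 2^n≤ l small = ^-cancelʳ-≤ c {{m*n≢0 k (suc k)}}
  -- This factor pays for the 2 in 2^n ≤ 2 m^k, which gets raised to the power t(k+1).
  (*-cancelˡ-≤ (2 ^ (suc k * t)) {{m^n≢0 2 (suc k * t)}} (begin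
    2 ^ (suc k * t) * (2 ^ n * (Y * (2 ^ l) ^ t)) ^ c
      ≤⟨ *-monoʳ-≤ (2 ^ (suc k * t)) (^-monoˡ-≤ c (*-monoʳ-≤ (2 ^ n) (*-monoˡ-≤ ((2 ^ l) ^ t) (m≤2^m Y)))) ⟩
    2 ^ (suc k * t) * (2 ^ n * (2 ^ Y * (2 ^ l) ^ t)) ^ c
      ≡⟨ collect ⟩
    2 ^ (suc k * t + (n + (Y + l * t)) * c)
      ≤⟨ ^-monoʳ-≤ 2 exponent ⟩
    2 ^ (n * (t * suc k))
      ≡⟨ ^-*-assoc 2 n (t * suc k) ⟨
    (2 ^ n) ^ (t * suc k)
      ≤⟨ ^-monoˡ-≤ (t * suc k) 2^n≤ ⟩
    (2 * m ^ k) ^ (t * suc k)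
      ≡⟨ ^-distribʳ-* (t * suc k) 2 (m ^ k) ⟩
    2 ^ (t * suc k) * (m ^ k) ^ (t * suc k)
      ≡⟨ cong₂ _*_ (cong (2 ^_) (*-comm t (suc k))) (trans (^-*-assoc m k (t * suc k))
           (trans (cong (m ^_) (reorder k t)) (sym (^-*-assoc m t c)))) ⟩
    2 ^ (suc k * t) * (m ^ t) ^ c ∎))
  where
  open ≤-Reasoning
  c = k * suc k
  reorder : ∀ k t → k * (t * (1 + k)) ≡ t * (k * (1 + k))
  reorder = solve-∀
  collect : 2 ^ (suc k * t) * (2 ^ n * (2 ^ Y * (2 ^ l) ^ t)) ^ c ≡ 2 ^ (suc k * t + (n + (Y + l * t)) * c)
  collect = begin-equality
    2 ^ (suc k * t) * (2 ^ n * (2 ^ Y * (2 ^ l) ^ t)) ^ c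
      ≡⟨ cong (λ e → 2 ^ (suc k * t) * (2 ^ n * (2 ^ Y * e)) ^ c) (^-*-assoc 2 l t) ⟩
    2 ^ (suc k * t) * (2 ^ n * (2 ^ Y * 2 ^ (l * t))) ^ c
      ≡⟨ cong (λ e → 2 ^ (suc k * t) * (2 ^ n * e) ^ c) (^-distribˡ-+-* 2 Y (l * t)) ⟨
    2 ^ (suc k * t) * (2 ^ n * 2 ^ (Y + l * t)) ^ c
      ≡⟨ cong (λ e → 2 ^ (suc k * t) * e ^ c) (^-distribˡ-+-* 2 n (Y + l * t)) ⟨
    2 ^ (suc k * t) * (2 ^ (n + (Y + l * t))) ^ c
      ≡⟨ cong (2 ^ (suc k * t) *_) (^-*-assoc 2 (n + (Y + l * t)) c) ⟩
    2 ^ (suc k * t) * 2 ^ ((n + (Y + l * t)) * c)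
      ≡⟨ ^-distribˡ-+-* 2 (suc k * t) _ ⟨
    2 ^ (suc k * t + (n + (Y + l * t)) * c) ∎
  expand : ∀ k t n Y l → (1 + k) * t + (n + (Y + l * t)) * (k * (1 + k)) ≡
    ((1 + k) * t + Y * (k * (1 + k))) + n * (k * (1 + k)) + t * k * ((1 + k) * l)
  expand = solve-∀
  factor : ∀ k t n → n + n * (k * (1 + k)) + t * k * n ≡ n * (1 + k * (1 + k)) + t * k * n
  factor = solve-∀
  factor′ : ∀ k t n → n * t + t * k * n ≡ n * (t * (1 + k))
  factor′ = solve-∀
  exponent : suc k * t + (n + (Y + l * t)) * c ≤ n * (t * suc k)
  exponent = begin
    suc k * t + (n + (Y + l * t)) * c                       ≡⟨ expand k t n Y l ⟩
    (suc k * t + Y * c) + n * c + t * k * (suc k * l)       ≤⟨ +-mono-≤ (+-monoˡ-≤ (n * c) n₀≤n) (*-monoʳ-≤ (t * k) small) ⟩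
    n + n * c + t * k * n                                   ≡⟨ factor k t n ⟩
    n * suc c + t * k * n                                   ≤⟨ +-monoˡ-≤ (t * k * n) (*-monoʳ-≤ n c<t) ⟩
    n * t + t * k * n                                       ≡⟨ factor′ k t n ⟩
    n * (t * suc k)                                         ∎

-- Each level of the induction on s weakens the density from 1/P to 1/Y; the maximum collects the
-- demands of `union-bound-tail` at all levels. The exponent t is a power of two exceeding k(k+1).
density-threshold : ℕ → ℕ → ℕ → ℕ
density-threshold k zero    P = 0
density-threshold k (suc s) P = (suc k * t + Y * (k * suc k)) ⊔ density-threshold k s Y
  where
  t = 2 ^ suc (k * suc k)
  Y = suc (2 * P ^ t)

module _ {n} (V : List (Subset n)) (uniq : Unique V) .{{_ : NonZero (length V)}} where

  open Tuples V

  -- Iterating `density-step` accounts for s disjoint sets of size at least (n+1)/(k+1) outside u;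
  -- the inequality says that they fit into [n], which fails for s = k + 1.
  dense-tuples⇒size-bound : ∀ k .{{_ : NonZero k}} → 2 ^ n ≤ 2 * length V ^ k →
    ∀ s P → density-threshold k s P ≤ n →
    ∀ u → length V ^ s ≤ P * a s u → s * suc n + suc k * ∣ u ∣ ≤ suc k * n
  dense-tuples⇒size-bound k 2^n≤ zero    P _    u _     = *-monoʳ-≤ (suc k) (∣p∣≤n u)
  dense-tuples⇒size-bound k 2^n≤ (suc s) P n₀≤n u dense =
    density-step V uniq k (suc (k * suc k)) s P u
      (union-bound-tail k t Y (length V) n (m≤2^m _) (m⊔n≤o⇒m≤o _ _ n₀≤n) 2^n≤)
      (dense-tuples⇒size-bound k 2^n≤ s Y (m⊔n≤o⇒n≤o (suc k * t + Y * (k * suc k)) _ n₀≤n))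
      dense
    where
    t = 2 ^ suc (k * suc k)
    Y = suc (2 * P ^ t)

-- Counting the representations of subsets

∑-const-≤ : {A : Set} {c : ℕ} {f : A → ℕ} {xs : List A} →
  All (λ x → c ≤ f x) xs → length xs * c ≤ ∑ xs f
∑-const-≤ []         = z≤n
∑-const-≤ (c≤ ∷ c≤s) = +-mono-≤ c≤ (∑-const-≤ c≤s)

≤-∑ : {A : Set} {f : A → ℕ} {x : A} {xs : List A} → x ∈ xs → f x ≤ ∑ xs f
≤-∑ (here refl) = m≤m+n _ _
≤-∑ {f = f} {xs = y ∷ _} (there x∈xs) = ≤-trans (≤-∑ x∈xs) (m≤n+m _ (f y))

module _ {n : ℕ} where

  nonempty? : (x : Subset n) → Dec (x ≢ ⊥)
  nonempty? x = ¬? (≡-dec Bool._≟_ x ⊥)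

  -- The empty set is disjoint from itself and may be repeated in a representation; removing it
  -- makes disjoint lists duplicate-free and keeps their union.
  nonempties : List (Subset n) → List (Subset n)
  nonempties = filter nonempty?

  ⋃-nonempties : ∀ ys → ⋃ (nonempties ys) ≡ ⋃ ys
  ⋃-nonempties [] = refl
  ⋃-nonempties (y ∷ ys) with ≡-dec Bool._≟_ y ⊥
  ... | yes refl = trans (⋃-nonempties ys) (sym (∪-identityˡ _))
  ... | no  _    = cong (y ∪_) (⋃-nonempties ys)

  ⋃-↭ : {xs ys : List (Subset n)} → xs ↭ ys → ⋃ xs ≡ ⋃ ys
  ⋃-↭ p = Permutationₛ.foldr-commMonoid (setoid (Subset n)) (∪-isCommutativeMonoid n) (↭⇒↭ₛ p)

  disjoint-sym : {x y : Subset n} → Disjoint x y → Disjoint y x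
  disjoint-sym {x} {y} = trans (∩-comm y x)

  disjoint⇒unique : {ys : List (Subset n)} → AllPairs Disjoint ys → All (_≢ ⊥) ys → Unique ys
  disjoint⇒unique []          []        = []
  disjoint⇒unique (y∥ ∷ ys∥) (y≢ ∷ ys≢) = All.map distinct y∥ ∷ disjoint⇒unique ys∥ ys≢
    where
    distinct : ∀ {z} → Disjoint _ z → _ ≢ z
    distinct y∥z refl = y≢ (trans (sym (∩-idem _)) y∥z)

module Representations {n} (V : List (Subset n)) where

  open Tuples V

  ∑-S : {A : Set} (xs : List A) (g : A → Subset n → ℕ) → ∀ s c z →
    ∑ xs (λ i → S s (g i) c z) ≡ S s (λ u → ∑ xs λ i → g i u) c z
  ∑-S xs g zero    c z = refl
  ∑-S xs g (suc s) c z = begin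
    ∑ xs (λ i → ∑ V (λ x → χ x c * S s (g i) (c ∪ x) (z ∪ x)))
      ≡⟨ ∑-swap xs V ⟩
    ∑ V (λ x → ∑ xs (λ i → χ x c * S s (g i) (c ∪ x) (z ∪ x)))
      ≡⟨ ∑-cong V (λ x → trans (∑-*ˡ xs (χ x c)) (cong (χ x c *_) (∑-S xs g s (c ∪ x) (z ∪ x)))) ⟩
    S (suc s) (λ u → ∑ xs λ i → g i u) c z ∎
    where open ≡-Reasoning

  reps : ℕ → Subset n → ℕ
  reps s x = S s (λ u → δ u x) ⊥ ⊥

  ∑-reps : ∀ s → ∑ (subsets n) (reps s) ≡ a s ⊥
  ∑-reps s = begin
    ∑ (subsets n) (reps s)                             ≡⟨ ∑-S (subsets n) (λ x u → δ u x) s ⊥ ⊥ ⟩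
    S s (λ u → ∑ (subsets n) (λ x → δ u x)) ⊥ ⊥        ≡⟨ S-cong s ⊥ ⊥ (λ u →
      trans (∑-cong (subsets n) (λ x → sym (*-identityʳ (δ u x)))) (∑-δ u)) ⟩
    S s (λ _ → 1) ⊥ ⊥                                  ≡⟨ S-1 s ⊥ ⊥ ⟩
    a s ⊥                                              ∎
    where open ≡-Reasoning

  -- The s! orderings of a disjoint representation of x are distinct s-tuples.
  orderings : ∀ s {c z x} ys → length ys ≡ s →
    AllPairs Disjoint ys → All (_≢ ⊥) ys → All (_∈ V) ys → All (λ y → χ y c ≡ 1) ys →
    z ∪ ⋃ ys ≡ x → s ! ≤ S s (λ u → δ u x) c z
  orderings zero {x = x} [] _ _ _ _ _ z∪⊥≡x
    rewrite trans (sym (∪-identityʳ _)) z∪⊥≡x = ≤-reflexive (sym (δ-refl x))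
  orderings (suc s) {c} {z} {x} ys len ys∥ ys≢ ys⊆V ys∥c z∪≡x = begin
    suc s * s !    ≡⟨ cong (_* s !) len ⟨
    length ys * s ! ≤⟨ ∑-const-≤ (All.tabulate first) ⟩
    ∑ ys F         ≤⟨ ∑-mono-⊆ (disjoint⇒unique ys∥ ys≢) ys⊆V ⟩
    ∑ V F          ∎
    where
    open ≤-Reasoning
    F : Subset n → ℕ
    F y = χ y c * S s (λ u → δ u x) (c ∪ y) (z ∪ y)
    -- Any y in `ys` may come first, leaving s! orderings of the others.
    first : ∀ {y} → y ∈ ys → s ! ≤ F y
    first {y} y∈ys with ∈-∃++ y∈ys
    ... | as , bs , refl = head (All-resp-↭ p ys≢) (All-resp-↭ p ys⊆V) (All-resp-↭ p ys∥c)
        (Permutationₛ.AllPairs-resp-↭ (setoid (Subset n)) disjoint-sym (resp₂ Disjoint) (↭⇒↭ₛ p) ys∥)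
      where
      p = shift y as bs
      zs = as ++ bs
      head : All (_≢ ⊥) (y ∷ zs) → All (_∈ V) (y ∷ zs) → All (λ w → χ w c ≡ 1) (y ∷ zs) →
        AllPairs Disjoint (y ∷ zs) → s ! ≤ F y
      head (_ ∷ zs≢) (_ ∷ zs⊆V) (y∥c ∷ zs∥c) (y∥zs ∷ zs∥) rewrite y∥c | *-identityˡ (S s (λ u → δ u x) (c ∪ y) (z ∪ y)) =
        orderings s zs (suc-injective (trans (sym (↭-length p)) len)) zs∥ zs≢ zs⊆V
          (All.map (λ {w} (w∥c , y∥w) → trans (χ-∪ w c y) (cong₂ _*_ w∥c (disjoint⇒χ≡1 (disjoint-sym y∥w))))
            (All.zip (zs∥c , y∥zs)))
          (trans (trans (∪-assoc z y (⋃ zs)) (cong (z ∪_) (sym (⋃-↭ p)))) z∪≡x)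

-- Each x has either a representation by exactly k + 1 nonempty members, hence (k+1)! ordered ones,
-- or a shorter one, which is given weight (k+1)!.
generator-count : ∀ k n (G : List (Subset n)) → IsKGenerator (suc k) n G →
  let V = nonempties G; open Tuples V in
  2 ^ n * suc k ! ≤ a (suc k) ⊥ + suc k ! * (suc k * suc (length V) ^ k)
generator-count k n G gen = begin
  2 ^ n * suc k !
    ≡⟨ cong (_* suc k !) (length-subsets n) ⟨
  length (subsets n) * suc k !
    ≤⟨ ∑-const-≤ {xs = subsets n} (All.tabulate (λ {x} _ → pointwise x)) ⟩
  ∑ (subsets n) (λ x → reps (suc k) x + suc k ! * ∑ (upTo (suc k)) (λ s → reps s x))
    ≡⟨ ∑-distrib-+ (subsets n) ⟩
  ∑ (subsets n) (reps (suc k)) + ∑ (subsets n) (λ x → suc k ! * ∑ (upTo (suc k)) (λ s → reps s x))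
    ≡⟨ cong₂ _+_ (∑-reps (suc k)) (trans (∑-*ˡ (subsets n) (suc k !)) (cong (suc k ! *_)
         (trans (∑-swap (subsets n) (upTo (suc k))) (∑-cong (upTo (suc k)) ∑-reps)))) ⟩
  a (suc k) ⊥ + suc k ! * ∑ (upTo (suc k)) (λ s → a s ⊥)
    ≤⟨ +-monoʳ-≤ (a (suc k) ⊥) (*-monoʳ-≤ (suc k !) short) ⟩
  a (suc k) ⊥ + suc k ! * (suc k * suc (length V) ^ k) ∎
  where
  open ≤-Reasoning
  V = nonempties G
  open Tuples V
  open Representations V

  pointwise : ∀ x → suc k ! ≤ reps (suc k) x + suc k ! * ∑ (upTo (suc k)) (λ s → reps s x)
  pointwise x with gen x
  ... | ys , len≤ , ys⊆G , ys∥ , ⋃ys≡x = by-length (m≤n⇒m<n∨m≡n (≤-trans (length-filter nonempty? ys) len≤))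
    where
    zs = nonempties ys
    zs⊆V : All (_∈ V) zs
    zs⊆V = All.tabulate λ w∈zs → let w∈ys , w≢⊥ = ∈-filter⁻ nonempty? {xs = ys} w∈zs in
      ∈-filter⁺ nonempty? (All.lookup ys⊆G w∈ys) w≢⊥
    rep : ∀ s → length zs ≡ s → s ! ≤ reps s x
    rep s len = orderings s zs len (AllPairs-filter⁺ nonempty? ys∥) (all-filter nonempty? ys) zs⊆V
      (All.tabulate (λ {w} _ → χ-⊥ w))
      (trans (∪-identityˡ _) (trans (⋃-nonempties ys) ⋃ys≡x))
    by-length : length zs < suc k ⊎ length zs ≡ suc k →
      suc k ! ≤ reps (suc k) x + suc k ! * ∑ (upTo (suc k)) (λ s → reps s x)
    by-length (inj₂ len) = ≤-trans (rep (suc k) len) (m≤m+n _ _)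
    by-length (inj₁ len<) = begin
      suc k !                                              ≡⟨ *-identityʳ (suc k !) ⟨
      suc k ! * 1                                          ≤⟨ *-monoʳ-≤ (suc k !) (begin
        1                                       ≤⟨ 1≤n! (length zs) ⟩
        length zs !                             ≤⟨ rep (length zs) refl ⟩
        reps (length zs) x                      ≤⟨ ≤-∑ {f = λ s → reps s x} (∈-upTo⁺ len<) ⟩
        ∑ (upTo (suc k)) (λ s → reps s x)       ∎) ⟩
      suc k ! * ∑ (upTo (suc k)) (λ s → reps s x)          ≤⟨ m≤n+m _ _ ⟩
      reps (suc k) x + suc k ! * ∑ (upTo (suc k)) (λ s → reps s x) ∎

  short : ∑ (upTo (suc k)) (λ s → a s ⊥) ≤ suc k * suc (length V) ^ k
  short = begin
    ∑ (upTo (suc k)) (λ s → a s ⊥)                     ≤⟨ bounded (upTo (suc k)) (All.tabulate ∈-upTo⁻) ⟩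
    length (upTo (suc k)) * suc (length V) ^ k         ≡⟨ cong (_* suc (length V) ^ k) (length-upTo (suc k)) ⟩
    suc k * suc (length V) ^ k                         ∎
    where
    bounded : ∀ is → All (_< suc k) is → ∑ is (λ s → a s ⊥) ≤ length is * suc (length V) ^ k
    bounded []       []           = z≤n
    bounded (s ∷ is) (s≤s s≤k ∷ is<) = +-mono-≤ (begin
      a s ⊥                  ≤⟨ a≤ s ⊥ ⟩
      -- The base m + 1 is positive even for empty `V`, so its powers increase with the exponent.
      length V ^ s           ≤⟨ ^-monoˡ-≤ s (n≤1+n (length V)) ⟩
      suc (length V) ^ s     ≤⟨ ^-monoʳ-≤ (suc (length V)) s≤k ⟩
      suc (length V) ^ k     ∎) (bounded is is<)

-- Few (k+1)-tuples force few k-tuples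

module _ {n} (V : List (Subset n)) where

  open Tuples V

  private
    m = length V
    A : ℕ → ℕ
    A s = a s ⊥

  -- The ratio A (s+1) / (m A s) is at most 1 - s/k + s/(D k), by downward induction on s = k - j.
  ratio-bound : ∀ D k → D * A (suc k) ≤ m * A k → ∀ j s → s + j ≡ k →
    D * k * A (suc s) ≤ (D * j + s) * (m * A s)
  ratio-bound D k few zero s s≡k rewrite trans (sym (+-identityʳ s)) s≡k = begin
    D * k * A (suc k)          ≡⟨ lemma₁ D k (A (suc k)) ⟩
    k * (D * A (suc k))        ≤⟨ *-monoʳ-≤ k few ⟩
    k * (m * A k)              ≡⟨ cong (_* (m * A k)) (lemma₂ D k) ⟩
    (D * 0 + k) * (m * A k)    ∎
    where
    open ≤-Reasoning
    lemma₁ : ∀ d k x → d * k * x ≡ k * (d * x)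
    lemma₁ = solve-∀
    lemma₂ : ∀ d k → k ≡ d * 0 + k
    lemma₂ = solve-∀
  ratio-bound D k few (suc j) s s+j≡k with A (suc s) in eq
  ... | zero  = subst (_≤ (D * suc j + s) * (m * A s)) (sym (*-zeroʳ (D * k))) z≤n
  -- Log-convexity is quadratic in A (s+1); the bound on the next ratio makes its right side
  -- proportional to A (s+1), and one such factor cancels.
  ... | suc b = *-cancelˡ-≤ (suc s * suc b) (begin
    suc s * suc b * (D * k * suc b)
      ≡⟨ lemma₁ (suc s) (suc b) (D * k) ⟩
    D * k * (suc s * (suc b * suc b))
      ≡⟨ cong (λ x → D * k * (suc s * (x * x))) eq ⟨
    D * k * (suc s * (A (suc s) * A (suc s)))
      ≤⟨ *-monoʳ-≤ (D * k) (clique-count-log-convexity s) ⟩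
    D * k * (A s * (m * A (suc s) + s * A (suc (suc s))))
      ≡⟨ lemma₂ (D * k) (A s) m (A (suc s)) s (A (suc (suc s))) ⟩
    A s * (D * k * m * A (suc s) + s * (D * k * A (suc (suc s))))
      ≤⟨ *-monoʳ-≤ (A s) (+-monoʳ-≤ (D * k * m * A (suc s)) (*-monoʳ-≤ s
           (ratio-bound D k few j (suc s) (trans (sym (+-suc s j)) s+j≡k)))) ⟩
    A s * (D * k * m * A (suc s) + s * ((D * j + suc s) * (m * A (suc s))))
      ≡⟨ cong₂ (λ k x → A s * (D * k * m * x + s * ((D * j + suc s) * (m * x)))) (sym s+j≡k) eq ⟩
    A s * (D * (s + suc j) * m * suc b + s * ((D * j + suc s) * (m * suc b)))
      ≡⟨ lemma₃ (A s) D s j m (suc b) ⟩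
    suc s * suc b * ((D * suc j + s) * (m * A s)) ∎)
    where
    open ≤-Reasoning
    lemma₁ : ∀ s b d → s * b * (d * b) ≡ d * (s * (b * b))
    lemma₁ = solve-∀
    lemma₂ : ∀ d x m y s z → d * (x * (m * y + s * z)) ≡ x * (d * m * y + s * (d * z))
    lemma₂ = solve-∀
    lemma₃ : ∀ x d s j m b →
      x * (d * (s + (1 + j)) * m * b + s * ((d * j + (1 + s)) * (m * b))) ≡
      (1 + s) * b * ((d * (1 + j) + s) * (m * x))
    lemma₃ = solve-∀

  -- The ratio bounds are multiplied together. Weakening D(j+1) + s to (D+k)(j+1) makes the factors
  -- j + 1 telescope to k!/j!.
  product-bound : ∀ D k → D * A (suc k) ≤ m * A k → ∀ s j → s + j ≡ k →
    (D * k) ^ s * A s * j ! ≤ (D + k) ^ s * k ! * m ^ s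
  product-bound D k few zero    j refl = ≤-reflexive (lemma (k !))
    where
    lemma : ∀ x → 1 * 1 * x ≡ 1 * x * 1
    lemma = solve-∀
  product-bound D k few (suc s) j s+j≡k = begin
    D * k * (D * k) ^ s * A (suc s) * j !
      ≡⟨ lemma₁ (D * k) ((D * k) ^ s) (A (suc s)) (j !) ⟩
    (D * k) ^ s * (j ! * (D * k * A (suc s)))
      ≤⟨ *-monoʳ-≤ ((D * k) ^ s) (*-monoʳ-≤ (j !) (ratio-bound D k few (suc j) s s+1+j≡k)) ⟩
    (D * k) ^ s * (j ! * ((D * suc j + s) * (m * A s)))
      ≤⟨ *-monoʳ-≤ ((D * k) ^ s) (*-monoʳ-≤ (j !) (*-monoˡ-≤ (m * A s) (begin
           D * suc j + s              ≤⟨ +-monoʳ-≤ (D * suc j) s≤k[1+j] ⟩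
           D * suc j + k * suc j      ≡⟨ *-distribʳ-+ (suc j) D k ⟨
           (D + k) * suc j            ∎))) ⟩
    (D * k) ^ s * (j ! * ((D + k) * suc j * (m * A s)))
      ≡⟨ lemma₂ ((D * k) ^ s) (j !) (D + k) (suc j) m (A s) ⟩
    (D + k) * m * ((D * k) ^ s * A s * suc j !)
      ≤⟨ *-monoʳ-≤ ((D + k) * m) (product-bound D k few s (suc j) s+1+j≡k) ⟩
    (D + k) * m * ((D + k) ^ s * k ! * m ^ s)
      ≡⟨ lemma₃ (D + k) m ((D + k) ^ s) (k !) (m ^ s) ⟩
    (D + k) ^ suc s * k ! * m ^ suc s ∎
    where
    open ≤-Reasoning
    s+1+j≡k : s + suc j ≡ k
    s+1+j≡k = trans (+-suc s j) s+j≡k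
    s≤k[1+j] : s ≤ k * suc j
    s≤k[1+j] = ≤-trans (m+n≤o⇒m≤o s (≤-reflexive s+1+j≡k)) (m≤m*n k (suc j))
    lemma₁ : ∀ d e x y → d * e * x * y ≡ e * (y * (d * x))
    lemma₁ = solve-∀
    lemma₂ : ∀ e y d j m x → e * (y * (d * j * (m * x))) ≡ d * m * (e * x * (j * y))
    lemma₂ = solve-∀
    lemma₃ : ∀ d m e y p → d * m * (e * y * p) ≡ d * e * y * (m * p)
    lemma₃ = solve-∀

  tuple-count-bound : ∀ D k → D * A (suc k) ≤ m * A k →
    (D * k) ^ k * A k ≤ (D + k) ^ k * k ! * m ^ k
  tuple-count-bound D k few =
    subst (_≤ (D + k) ^ k * k ! * m ^ k) (*-identityʳ _) (product-bound D k few k 0 (+-identityʳ k))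

-- Asymptotics

-- As m = O(2^(n/K)), (m+1)^k falls short of 2^n by a factor of order 2^(n/K). In K-th powers this
-- is a spare factor 2^n, which is at least n and so dominates the constants.
lower-order : ∀ E k m n → let K = suc k in
  m ^ K ≤ K ^ K * 2 ^ n → E ^ K * K ^ K * ((2 * K) ^ K) ^ k ≤ n →
  E * (K * suc m ^ k) ≤ 2 ^ n
lower-order E k m n m^K≤ n₀≤n = ^-cancelʳ-≤ K (begin
  (E * (K * suc m ^ k)) ^ K                               ≡⟨ trans (^-distribʳ-* K E _) (cong (E ^ K *_) (^-distribʳ-* K K (suc m ^ k))) ⟩
  E ^ K * (K ^ K * (suc m ^ k) ^ K)                       ≡⟨ cong (λ x → E ^ K * (K ^ K * x)) exchange ⟩
  E ^ K * (K ^ K * (suc m ^ K) ^ k)                       ≤⟨ *-monoʳ-≤ (E ^ K) (*-monoʳ-≤ (K ^ K) (^-monoˡ-≤ k (1+m-bound m m^K≤))) ⟩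
  E ^ K * (K ^ K * ((2 * K) ^ K * 2 ^ n) ^ k)             ≡⟨ cong (λ x → E ^ K * (K ^ K * x)) (^-distribʳ-* k ((2 * K) ^ K) (2 ^ n)) ⟩
  E ^ K * (K ^ K * (((2 * K) ^ K) ^ k * (2 ^ n) ^ k))     ≡⟨ lemma (E ^ K) (K ^ K) (((2 * K) ^ K) ^ k) ((2 ^ n) ^ k) ⟩
  E ^ K * K ^ K * ((2 * K) ^ K) ^ k * (2 ^ n) ^ k         ≤⟨ *-monoˡ-≤ ((2 ^ n) ^ k) (≤-trans n₀≤n (m≤2^m n)) ⟩
  (2 ^ n) ^ K                                             ∎)
  where
  open ≤-Reasoning
  K = suc k
  lemma : ∀ p q r s → p * (q * (r * s)) ≡ p * q * r * s
  lemma = solve-∀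
  exchange : (suc m ^ k) ^ K ≡ (suc m ^ K) ^ k
  exchange = trans (^-*-assoc (suc m) k K) (trans (cong (suc m ^_) (*-comm k K)) (sym (^-*-assoc (suc m) K k)))
  1+m-bound : ∀ m → m ^ K ≤ K ^ K * 2 ^ n → suc m ^ K ≤ (2 * K) ^ K * 2 ^ n
  1+m-bound zero    _ = begin
    1 ^ K                     ≡⟨ ^-zeroˡ K ⟩
    1 * 1                     ≤⟨ *-mono-≤ (m^n>0 (2 * K) K) (m^n>0 2 n) ⟩
    (2 * K) ^ K * 2 ^ n       ∎
  1+m-bound m@(suc m′) h = begin
    suc m ^ K                 ≤⟨ ^-monoˡ-≤ K (s≤s (subst (m ≤_) (sym (+-suc m′ (m′ + 0))) (s≤s (m≤m+n m′ _)))) ⟩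
    (2 * m) ^ K               ≡⟨ ^-distribʳ-* K 2 m ⟩
    2 ^ K * m ^ K             ≤⟨ *-monoʳ-≤ (2 ^ K) h ⟩
    2 ^ K * (K ^ K * 2 ^ n)   ≡⟨ *-assoc (2 ^ K) (K ^ K) (2 ^ n) ⟨
    2 ^ K * K ^ K * 2 ^ n     ≡⟨ cong (_* 2 ^ n) (^-distribʳ-* K 2 K) ⟨
    (2 * K) ^ K * 2 ^ n       ∎

-- For q = p + r: D q ≥ K r (e + 1), whereas (D + K) r = K r e.
slack : ∀ k p r → 0 < p → let K = suc k; D = 2 * (K * r); e = 2 * r + 1 in
  suc e * ((D + K) * (r * K)) ^ K ≤ e * (D * K * (p + r)) ^ K
slack k p r 0<p = begin
  suc e * ((D + K) * (r * K)) ^ K        ≡⟨ cong (λ x → suc e * x ^ K) (lemma₁ K r) ⟩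
  suc e * (b * e) ^ K                    ≡⟨ cong (suc e *_) (^-distribʳ-* K b e) ⟩
  suc e * (b ^ K * (e * e ^ k))          ≡⟨ lemma₂ (suc e) (b ^ K) e (e ^ k) ⟩
  e * (b ^ K * (suc e * e ^ k))          ≤⟨ *-monoʳ-≤ e (*-monoʳ-≤ (b ^ K) (*-monoʳ-≤ (suc e) (^-monoˡ-≤ k (n≤1+n e)))) ⟩
  e * (b ^ K * suc e ^ K)                ≡⟨ cong (e *_) (^-distribʳ-* K b (suc e)) ⟨
  e * (b * suc e) ^ K                    ≡⟨ cong (λ x → e * x ^ K) (lemma₃ K r) ⟩
  e * (D * K * (1 + r)) ^ K              ≤⟨ *-monoʳ-≤ e (^-monoˡ-≤ K (*-monoʳ-≤ (D * K) (+-monoˡ-≤ r 0<p))) ⟩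
  e * (D * K * (p + r)) ^ K              ∎
  where
  open ≤-Reasoning
  K = suc k
  D = 2 * (K * r)
  e = 2 * r + 1
  b = K * r * K
  lemma₁ : ∀ K r → (2 * (K * r) + K) * (r * K) ≡ K * r * K * (2 * r + 1)
  lemma₁ = solve-∀
  lemma₂ : ∀ p q r s → p * (q * (r * s)) ≡ r * (q * (p * s))
  lemma₂ = solve-∀
  lemma₃ : ∀ K r → K * r * K * (1 + (2 * r + 1)) ≡ 2 * (K * r) * K * (1 + r)
  lemma₃ = solve-∀

-- The first term makes (K+1)-tuples rare by the factor D; the second bounds the number of tuples
-- shorter than K by 2^n / E.
threshold : ℕ → ℕ → ℕ
threshold k r = density-threshold K (suc K) (2 * K ^ K * D) ⊔ (E ^ K * K ^ K * ((2 * K) ^ K) ^ k)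
  where
  K = suc k
  D = 2 * (K * r)
  E = suc (2 * r + 1)

-- Otherwise disjoint (K+1)-tuples would form a proportion of at least 1/(2 K^K D) of all m^(K+1),
-- and the size bound with s = K + 1 and u = ⊥ would give (K+1)(n+1) ≤ (K+1)n.
few-tuples : ∀ k D {n} (V : List (Subset n)) → let K = suc k; open Tuples V in
  Unique V → length V ^ K ≤ K ^ K * 2 ^ n → 2 ^ n ≤ 2 * a K ⊥ →
  density-threshold K (suc K) (2 * K ^ K * D) ≤ n →
  D * a (suc K) ⊥ ≤ length V * a K ⊥
few-tuples k D {n} V uniq m^K≤ half n₀≤n = ≮⇒≥ λ many → <⇒≱ (too-large n) (subst (_≤ suc K * n)
    (trans (cong (λ c → suc K * suc n + suc K * c) (∣⊥∣≡0 n))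
           (trans (cong (suc K * suc n +_) (*-zeroʳ (suc K))) (+-identityʳ _)))
    (dense-tuples⇒size-bound V uniq {{m≢0}} K 2^n≤2m^K (suc K) (2 * K ^ K * D) n₀≤n ⊥ (dense (<⇒≤ many))))
  where
  open ≤-Reasoning
  open Tuples V
  K = suc k
  m = length V
  2^n≤2m^K : 2 ^ n ≤ 2 * m ^ K
  2^n≤2m^K = ≤-trans half (*-monoʳ-≤ 2 (a≤ K ⊥))
  m≢0 : NonZero m
  m≢0 = ≢-nonZero λ m≡0 → <⇒≱ (m^n>0 2 n) (subst (λ l → 2 ^ n ≤ 2 * l ^ K) m≡0 2^n≤2m^K)
  too-large : ∀ n → suc K * n < suc K * suc n
  too-large n = *-monoʳ-< (suc K) (n<1+n n)
  lemma : ∀ m x y → m * (x * (2 * y)) ≡ 2 * x * (m * y)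
  lemma = solve-∀
  dense : m * a K ⊥ ≤ D * a (suc K) ⊥ → m ^ suc K ≤ 2 * K ^ K * D * a (suc K) ⊥
  dense many = begin
    m * m ^ K                        ≤⟨ *-monoʳ-≤ m m^K≤ ⟩
    m * (K ^ K * 2 ^ n)              ≤⟨ *-monoʳ-≤ m (*-monoʳ-≤ (K ^ K) half) ⟩
    m * (K ^ K * (2 * a K ⊥))        ≡⟨ lemma m (K ^ K) (a K ⊥) ⟩
    2 * K ^ K * (m * a K ⊥)          ≤⟨ *-monoʳ-≤ (2 * K ^ K) many ⟩
    2 * K ^ K * (D * a (suc K) ⊥)    ≡⟨ *-assoc (2 * K ^ K) D _ ⟨
    2 * K ^ K * D * a (suc K) ⊥      ∎

-- The case ε = p/(p+r), in K-th powers. If it failed, then m = O(2^(n/K)), so `lower-order` and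
-- `few-tuples` apply, and the resulting lower and upper bounds on `a K ⊥` clash by `slack`.
generator-size : ∀ k p r → 0 < p → 0 < r → ∀ n → threshold k r ≤ n →
  (G : List (Subset n)) → Unique G → IsKGenerator (suc k) n G →
  (r * suc k) ^ suc k * 2 ^ n ≤ ((p + r) * length G) ^ suc k
generator-size k p r 0<p 0<r n n₀≤n G uniq gen = ≮⇒≥ λ small → <-irrefl refl (absurd small)
  where
  open ≤-Reasoning
  K = suc k
  q = p + r
  V = nonempties G
  m = length V
  L = length G
  open Tuples V
  D = 2 * (K * r)
  e = 2 * r + 1
  E = suc e
  X = K * suc m ^ k
  absurd : (q * L) ^ K < (r * K) ^ K * 2 ^ n →
    E * ((D + K) * (r * K)) ^ K * 2 ^ n < E * ((D + K) * (r * K)) ^ K * 2 ^ n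
  absurd small = begin-strict
    E * ((D + K) * (r * K)) ^ K * 2 ^ n                   ≤⟨ *-monoˡ-≤ (2 ^ n) (slack k p r 0<p) ⟩
    e * (D * K * q) ^ K * 2 ^ n                           ≡⟨ cong (λ x → e * x * 2 ^ n) (^-distribʳ-* K (D * K) q) ⟩
    e * ((D * K) ^ K * q ^ K) * 2 ^ n                     ≡⟨ move₁ e ((D * K) ^ K) (q ^ K) (2 ^ n) ⟩
    q ^ K * ((D * K) ^ K * (e * 2 ^ n))                   ≤⟨ *-monoʳ-≤ (q ^ K) main ⟩
    q ^ K * (E * (D + K) ^ K * m ^ K)                     ≡⟨ move₂ (q ^ K) (E * (D + K) ^ K) (m ^ K) ⟩
    E * (D + K) ^ K * (q ^ K * m ^ K)                     ≡⟨ cong (E * (D + K) ^ K *_) (^-distribʳ-* K q m) ⟨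
    E * (D + K) ^ K * (q * m) ^ K                         <⟨ *-monoʳ-< (E * (D + K) ^ K) {{m*n≢0 E _ {{it}} {{m^n≢0 (D + K) K {{D+K≢0}}}}}} qm< ⟩
    E * (D + K) ^ K * ((r * K) ^ K * 2 ^ n)               ≡⟨ move₃ E ((D + K) ^ K) ((r * K) ^ K) (2 ^ n) ⟩
    E * ((D + K) ^ K * (r * K) ^ K) * 2 ^ n               ≡⟨ cong (λ x → E * x * 2 ^ n) (^-distribʳ-* K (D + K) (r * K)) ⟨
    E * ((D + K) * (r * K)) ^ K * 2 ^ n                   ∎
    where
    D+K≢0 : NonZero (D + K)
    D+K≢0 = >-nonZero (≤-trans (s≤s z≤n) (m≤n+m K D))
    move₁ : ∀ x y z w → x * (y * z) * w ≡ z * (y * (x * w))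
    move₁ = solve-∀
    move₂ : ∀ x y z → x * (y * z) ≡ y * (x * z)
    move₂ = solve-∀
    move₃ : ∀ x y z w → x * y * (z * w) ≡ x * (y * z) * w
    move₃ = solve-∀
    qm< : (q * m) ^ K < (r * K) ^ K * 2 ^ n
    qm< = ≤-<-trans (^-monoˡ-≤ K (*-monoʳ-≤ q (length-filter nonempty? G))) small
    m^K≤ : m ^ K ≤ K ^ K * 2 ^ n
    m^K≤ = *-cancelˡ-≤ (q ^ K) {{m^n≢0 q K {{>-nonZero (≤-trans 0<p (m≤m+n p r))}}}} (begin
      q ^ K * m ^ K               ≡⟨ ^-distribʳ-* K q m ⟨
      (q * m) ^ K                 ≤⟨ <⇒≤ qm< ⟩
      (r * K) ^ K * 2 ^ n         ≡⟨ cong (_* 2 ^ n) (^-distribʳ-* K r K) ⟩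
      r ^ K * K ^ K * 2 ^ n       ≤⟨ *-monoˡ-≤ (2 ^ n) (*-monoˡ-≤ (K ^ K) (^-monoˡ-≤ K (m≤n+m r p))) ⟩
      q ^ K * K ^ K * 2 ^ n       ≡⟨ *-assoc (q ^ K) (K ^ K) (2 ^ n) ⟩
      q ^ K * (K ^ K * 2 ^ n)     ∎)
    EX≤ : E * X ≤ 2 ^ n
    EX≤ = lower-order E k m n m^K≤ (m⊔n≤o⇒n≤o (density-threshold K (suc K) (2 * K ^ K * D)) _ n₀≤n)
    -- Shorter representations use up at most a fraction 1/E of K! 2^n, which leaves e/E for the
    -- K-tuples.
    many-tuples : e * (2 ^ n * K !) ≤ E * a K ⊥
    many-tuples = +-cancelʳ-≤ (K ! * 2 ^ n) _ _ (begin
      e * (2 ^ n * K !) + K ! * 2 ^ n       ≡⟨ lem₁ e (2 ^ n) (K !) ⟩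
      E * (2 ^ n * K !)                     ≤⟨ *-monoʳ-≤ E (generator-count k n G gen) ⟩
      E * (a K ⊥ + K ! * X)                 ≡⟨ lem₂ E (a K ⊥) (K !) X ⟩
      E * a K ⊥ + K ! * (E * X)             ≤⟨ +-monoʳ-≤ (E * a K ⊥) (*-monoʳ-≤ (K !) EX≤) ⟩
      E * a K ⊥ + K ! * 2 ^ n               ∎)
      where
      lem₁ : ∀ e x y → e * (x * y) + y * x ≡ (1 + e) * (x * y)
      lem₁ = solve-∀
      lem₂ : ∀ e x y z → e * (x + y * z) ≡ e * x + y * (e * z)
      lem₂ = solve-∀
    half : 2 ^ n ≤ 2 * a K ⊥
    half = ≤-trans (m≤m*n (2 ^ n) (K !) {{K !≢0}}) (*-cancelˡ-≤ e {{e≢0}} (begin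
      e * (2 ^ n * K !)       ≤⟨ many-tuples ⟩
      E * a K ⊥               ≤⟨ *-monoˡ-≤ (a K ⊥) (subst (E ≤_) (lem e) (+-monoˡ-≤ e 1≤e)) ⟩
      e * 2 * a K ⊥           ≡⟨ *-assoc e 2 _ ⟩
      e * (2 * a K ⊥)         ∎))
      where
      1≤e : 1 ≤ e
      1≤e = m≤n+m 1 (2 * r)
      e≢0 : NonZero e
      e≢0 = >-nonZero 1≤e
      lem : ∀ e → e + e ≡ e * 2
      lem = solve-∀
    main : (D * K) ^ K * (e * 2 ^ n) ≤ E * (D + K) ^ K * m ^ K
    main = *-cancelˡ-≤ (K !) {{K !≢0}} (begin
      K ! * ((D * K) ^ K * (e * 2 ^ n))      ≡⟨ lem₁ (K !) ((D * K) ^ K) e (2 ^ n) ⟩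
      (D * K) ^ K * (e * (2 ^ n * K !))      ≤⟨ *-monoʳ-≤ ((D * K) ^ K) many-tuples ⟩
      (D * K) ^ K * (E * a K ⊥)              ≡⟨ move₂ ((D * K) ^ K) E (a K ⊥) ⟩
      E * ((D * K) ^ K * a K ⊥)              ≤⟨ *-monoʳ-≤ E (tuple-count-bound V D K
        (few-tuples k D V (Unique-filter⁺ nonempty? uniq) m^K≤ half (m⊔n≤o⇒m≤o _ _ n₀≤n))) ⟩
      E * ((D + K) ^ K * K ! * m ^ K)        ≡⟨ lem₂ E ((D + K) ^ K) (K !) (m ^ K) ⟩
      K ! * (E * (D + K) ^ K * m ^ K)        ∎)
      where
      lem₁ : ∀ x y z w → x * (y * (z * w)) ≡ y * (z * (w * x))
      lem₁ = solve-∀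
      lem₂ : ∀ x y z w → x * (y * z * w) ≡ z * (x * y * w)
      lem₂ = solve-∀

-- Here ε = p/q, and k-th powers clear the root in 2^(n/k); the first alternative is the trivial
-- range ε ≥ 1.
theorem4 : (k : ℕ) → 1 ≤ k → (p q : ℕ) → 0 < p → 0 < q →
    Σ ℕ λ n₀ → (n : ℕ) → n₀ ≤ n → (G : List (Subset n)) → Unique G →
    IsKGenerator k n G →
    q ≤ p ⊎ ((q ∸ p) * k) ^ k * 2 ^ n ≤ (q * length G) ^ k
theorem4 (suc k) _ p q 0<p _ with q ≤? p
... | yes q≤p = 0 , λ _ _ _ _ _ → inj₁ q≤p
... | no  q≰p = threshold k (q ∸ p) , λ n n₀≤n G uniq gen → inj₂
  (subst (λ q′ → ((q ∸ p) * suc k) ^ suc k * 2 ^ n ≤ (q′ * length G) ^ suc k) (m+[n∸m]≡n (≰⇒≥ q≰p))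
    (generator-size k p (q ∸ p) 0<p (m<n⇒0<n∸m (≰⇒> q≰p)) n n₀≤n G uniq gen))
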